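{- Let $G$ be a simple connected graph with $n$ vertices having diameter $d=2$, maximum vertex degree $\Delta(G)$ and independence number $\alpha(G)$. Then $$DLS(G)\geq \Delta(G)+\alpha(G)+1-n.$$
   Context: All graphs are finite, simple and connected. For a connected graph $G$ on vertices $v_1,\dots,v_n$, $d_{uv}$ denotes the distance (length of a shortest path) between $u$ and $v$, and $D(G)=(d_{uv})$ is the distance matrix. The diameter is the maximum distance between two vertices. The independence number $\alpha(G)$ is the maximum cardinality of a set of pairwise non-adjacent vertices. The transmission of a vertex $v$ is $Tr(v)=\sum_{u\in V(G)}d_{uv}$. The distance Laplacian matrix is $D^L(G)=\mathrm{diag}(Tr(v_1),\dots,Tr(v_n))-D(G)$; it is positive semidefinite, and its eigenvalues, with multiplicity, are written $\partial_1^L(G)\ge \partial_2^L(G)\ge\dots\ge\partial_n^L(G)=0$. The distance Laplacian spread is $DLS(G)=\partial_1^L(G)-\partial_{n-1}^L(G)$. -}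

module Defs where

open import Level as Level using (0ℓ; _⊔_)
open import Algebra.Apartness.Bundles using (HeytingField; module HeytingCommutativeRing)
open import Algebra.Bundles using (module CommutativeRing; module Semiring)
import Algebra.Definitions.RawSemiring as RawSemiringDefinitions
open import Data.Bool.Base using (if_then_else_)
open import Data.Fin.Base as Fin using (Fin; zero; suc; toℕ; fromℕ; inject₁; punchIn)
open import Data.Fin.Properties using (any?; _≟_)
open import Data.Fin.Subset using (Subset; _∈_; ∣_∣)
open import Data.Nat.Base as ℕ using (ℕ; z≤n; s≤s)
import Data.Nat.Properties as ℕ
open import Data.Product.Base using (∃; ∃₂; _×_; _,_; proj₁)
open import Data.Sum.Base using (_⊎_)
open import Data.Vec.Base using (tabulate)
open import Data.Vec.Functional using (Vector)
open import Relation.Binary.Core using (Rel)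
open import Relation.Binary.Definitions using (Symmetric; Irreflexive; Decidable)
open import Relation.Binary.PropositionalEquality using (_≡_; subst)
open import Relation.Binary.Structures using (IsStrictPartialOrder)
open import Relation.Nullary using (¬_; Dec; yes; no; does; contradiction; _×-dec_)
import Relation.Unary as U

IsLeast IsGreatest : (ℕ → Set) → ℕ → Set
IsLeast    P k = P k × (∀ m → P m → k ℕ.≤ m)
IsGreatest P k = P k × (∀ m → P m → m ℕ.≤ k)

least : {P : ℕ → Set} → U.Decidable P → ∀ b → P b → ∃ (IsLeast P)
least P? b pb with P? 0
... | yes p0 = 0 , p0 , λ _ _ → z≤n
least P? 0         pb | no ¬p0 = contradiction pb ¬p0
least {P} P? (ℕ.suc b) pb | no ¬p0 with least (λ k → P? (ℕ.suc k)) b pb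
... | k , pk , k-min = ℕ.suc k , pk , minimal
  where
  minimal : ∀ m → P m → ℕ.suc k ℕ.≤ m
  minimal 0         p0 = contradiction p0 ¬p0
  minimal (ℕ.suc m) pm = s≤s (k-min m pm)

record Graph (n : ℕ) : Set₁ where
  infix 4 _~_ _~?_
  field
    _~_      : Rel (Fin n) 0ℓ
    _~?_     : Decidable _~_
    ~-sym    : Symmetric _~_
    ~-irrefl : Irreflexive _≡_ _~_

module _ {n : ℕ} (G : Graph n) where
  open Graph G

  Walk : ℕ → Rel (Fin n) 0ℓ
  Walk 0         u v = u ≡ v
  Walk (ℕ.suc k) u v = ∃ λ w → u ~ w × Walk k w v

  walk? : ∀ k → Decidable (Walk k)
  walk? 0         u v = u ≟ v
  walk? (ℕ.suc k) u v = any? λ w → (u ~? w) ×-dec walk? k w v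

  Connected : Set
  Connected = ∀ u v → ∃ λ k → Walk k u v

  neighbours : Fin n → Subset n
  neighbours v = tabulate λ w → does (v ~? w)

  degree : Fin n → ℕ
  degree v = ∣ neighbours v ∣

  IsMaxDegree : ℕ → Set
  IsMaxDegree = IsGreatest λ k → ∃ λ v → degree v ≡ k

  Independent : Subset n → Set
  Independent S = ∀ {u v} → u ∈ S → v ∈ S → ¬ (u ~ v)

  IsIndependenceNumber : ℕ → Set
  IsIndependenceNumber = IsGreatest λ k → ∃ λ S → Independent S × ∣ S ∣ ≡ k

  module _ (connected : Connected) where

    -- A shortest walk repeats no vertex, so minimising over walks is the
    -- same as minimising over paths.
    distance : Fin n → Fin n → ℕ
    distance u v with connected u v
    ... | b , walk = proj₁ (least (λ k → walk? k u v) b walk)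

    IsDiameter : ℕ → Set
    IsDiameter = IsGreatest λ k → ∃₂ λ u v → distance u v ≡ k

    transmission : Fin n → ℕ
    transmission v = sum λ u → distance u v
      where open RawSemiringDefinitions ℕ.+-*-rawSemiring using (sum)

-- The real numbers, characterised axiomatically as an Archimedean, Cauchy
-- complete ordered field. The axioms are constructive (no trichotomy is
-- assumed); classically ℝ is, up to isomorphism, the only model.
record RealField c ℓ₁ ℓ₂ ℓ₃ : Set (Level.suc (c ⊔ ℓ₁ ⊔ ℓ₂ ⊔ ℓ₃)) where
  infix 4 _<_ _≤_
  field
    heytingField : HeytingField c ℓ₁ ℓ₂

  open HeytingField heytingField public
  open HeytingCommutativeRing heytingCommutativeRing public using (commutativeRing)

  open CommutativeRing commutativeRing public using (semiring)
  open RawSemiringDefinitions (Semiring.rawSemiring semiring) public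
    using (_^_; sum; product) renaming (_×_ to _·_)

  fromNat : ℕ → Carrier
  fromNat k = k · 1#

  field
    _<_                    : Rel Carrier ℓ₃
    <-isStrictPartialOrder : IsStrictPartialOrder _≈_ _<_
    #⇒<⊎>                  : ∀ {x y} → x # y → x < y ⊎ y < x
    <⇒#                    : ∀ {x y} → x < y → x # y
    +-monoˡ-<              : ∀ z {x y} → x < y → x + z < y + z
    *-positive             : ∀ {x y} → 0# < x → 0# < y → 0# < x * y
    archimedean            : ∀ x → ∃ λ k → x < fromNat k

  _≤_ : Rel Carrier ℓ₃
  x ≤ y = ¬ (y < x)

  ∣_-_∣<_ : Carrier → Carrier → Carrier → Set ℓ₃
  ∣ x - y ∣< ε = (x + - y < ε) × (y + - x < ε)

  Cauchy : (ℕ → Carrier) → Set (c ⊔ ℓ₃)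
  Cauchy s = ∀ ε → 0# < ε → ∃ λ N → ∀ i j → N ℕ.≤ i → N ℕ.≤ j → ∣ s i - s j ∣< ε

  ConvergesTo : (ℕ → Carrier) → Carrier → Set (c ⊔ ℓ₃)
  ConvergesTo s l = ∀ ε → 0# < ε → ∃ λ N → ∀ i → N ℕ.≤ i → ∣ s i - l ∣< ε

  field
    complete : ∀ s → Cauchy s → ∃ (ConvergesTo s)

module Spectra {c ℓ₁ ℓ₂ ℓ₃} (ℝ : RealField c ℓ₁ ℓ₂ ℓ₃) where
  open RealField ℝ hiding (zero)

  Matrix : ℕ → Set c
  Matrix n = Fin n → Fin n → Carrier

  diag : ∀ {n} → Vector Carrier n → Matrix n
  diag a i j = if does (i ≟ j) then a i else 0#

  -- Laplace expansion along the first row.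
  det : ∀ {n} → Matrix n → Carrier
  det {0}       A = 1#
  det {ℕ.suc n} A =
    sum λ j → (- 1#) ^ toℕ j * A zero j * det λ r s → A (suc r) (punchIn j s)

  charPoly : ∀ {n} → Matrix n → Carrier → Carrier
  charPoly M t = det λ i j → diag (λ _ → t) i j - M i j

  -- ∂ lists the eigenvalues of M, repeated according to multiplicity, in
  -- non-increasing order. As the field is infinite, equality of the
  -- polynomial functions below is equality of polynomials.
  record IsSpectrum {n} (M : Matrix n) (∂ : Vector Carrier n) : Set (c ⊔ ℓ₁ ⊔ ℓ₃) where
    field
      nonIncreasing : ∀ {i j} → i Fin.≤ j → ∂ j ≤ ∂ i
      factorisation : ∀ t → charPoly M t ≈ product λ i → t - ∂ i

  distanceLaplacian : ∀ {n} (G : Graph n) → Connected G → Matrix n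
  distanceLaplacian G conn u v =
    diag (λ w → fromNat (transmission G conn w)) u v - fromNat (distance G conn u v)

  -- ∂₁ − ∂ₙ₋₁, where positions are counted from 1; there is no position n − 1
  -- when n < 2, and the value 0 is then arbitrary.
  spread : ∀ {n} → Vector Carrier n → Carrier
  spread {0}               ∂ = 0#
  spread {1}               ∂ = 0#
  spread {ℕ.suc (ℕ.suc m)} ∂ = ∂ zero - ∂ (inject₁ (fromℕ m))

{-# OPTIONS --safe #-}
-- As no distance exceeds two, the distance Laplacian L satisfies
-- n‖x‖² ≤ ⟨x, Lx⟩ ≤ 2n‖x‖² on the complement of the constant vectors.
-- There e_u − e_v, for u and v in a maximum independent set, has Rayleigh
-- quotient at least n + α, and Δ e_v minus the indicator of the neighbours of a
-- vertex v of maximum degree has Rayleigh quotient at most 2n − Δ − 1. So it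
-- suffices that ∂₁ bounds the quotients from above and ∂ₙ₋₁ bounds them from below.
--
-- No spectral theorem is used for this. If t keeps away from the eigenvalues then
-- det (t − L) keeps away from 0, so by Cramer's rule ‖(t − L) x‖² ≥ δ‖x‖² uniformly
-- in t. A form ⟨x, Px⟩ that is nonnegative and at most T‖x‖² satisfies
-- ‖Px‖² ≤ T⟨x, Px⟩, hence is even at least (δ/T)‖x‖². Semidefiniteness of ± (t − L)
-- therefore survives moving t by δ/T, and finitely many such steps carry it from 2n
-- (respectively n) to any bound strictly separated from the eigenvalues.
module Submission where

open import Defs
open import Data.Nat.Base using (ℕ)
open import Data.Vec.Functional using (Vector)
open import Algebra.Apartness.Properties.HeytingCommutativeRing using (1#0)
open import Algebra.Bundles using (CommutativeRing)
import Algebra.Definitions.RawSemiring as RawSemiringDefinitions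
import Algebra.Properties.AbelianGroup as AbelianGroupProperties
import Algebra.Properties.CommutativeSemigroup as CommutativeSemigroupProperties
import Algebra.Properties.Group as GroupProperties
import Algebra.Properties.Ring as RingProperties
import Algebra.Properties.Semiring.Mult as MultProperties
import Algebra.Properties.Semiring.Mult.TCOptimised as TCOptimisedMultProperties
import Algebra.Properties.Semiring.Sum as SumProperties
import Algebra.Solver.Ring
open import Algebra.Solver.Ring.AlmostCommutativeRing
  using (fromCommutativeRing; _-Raw-AlmostCommutative⟶_)
open import Data.Bool.Base using (Bool; true; false; if_then_else_)
open import Data.Fin.Base as Fin using (Fin; zero; suc; toℕ; fromℕ; inject₁; punchIn; punchOut)
open import Data.Fin.Properties
  using (_≟_; toℕ-injective; toℕ-inject₁; toℕ-fromℕ; toℕ≤pred[n]; <⇒≢;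
         punchInᵢ≢i; punchIn-injective; punchIn-punchOut)
open import Data.Fin.Subset as Subset using (Subset; _∈_; _∪_; ⁅_⁆; ∣_∣; inside; outside)
open import Data.Fin.Subset.Properties
  using (x∈⁅x⁆; x∈⁅y⁆⇒x≡y; x∈p∪q⁻; x∈p∪q⁺; x∈p⇒∣p-x∣<∣p∣; x∈p∧x≢y⇒x∈p-y; ∣p∣≤n)
open import Data.Integer.Base as ℤ using (ℤ; -[1+_]; _⊖_; _◃_)
import Data.Integer.Properties as ℤ
open import Data.Maybe.Base using (just; nothing)
open import Data.Nat.Base as ℕ using (zero; suc)
import Data.Nat.Properties as ℕ
open import Data.Product.Base using (∃; ∃₂; _×_; _,_; proj₁; proj₂)
open import Data.Sign.Base as Sign using (Sign)
open import Data.Sum.Base using (_⊎_; inj₁; inj₂; [_,_])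
open import Data.Vec.Base using ([]; _∷_; lookup; here; there)
open import Data.Vec.Functional using (updateAt)
open import Data.Vec.Functional.Properties using (updateAt-updates; updateAt-minimal)
open import Data.Vec.Properties using (lookup⇒[]=; lookup∘tabulate)
open import Function.Base using (_∘_)
open import Level using (Level; _⊔_)
open import Relation.Binary.Definitions using (WeaklyDecidable)
open import Relation.Binary.PropositionalEquality as ≡ using (_≡_; _≢_)
import Relation.Binary.Reasoning.Base.Triple as TripleReasoning
import Relation.Binary.Reasoning.Setoid as SetoidReasoning
open import Relation.Binary.Structures using (IsStrictPartialOrder; IsPreorder)
open import Relation.Nullary using (¬_; Dec; does; yes; no; contradiction)
open import Relation.Nullary.Decidable using (dec-true)

-- The field has no decidable order and a spectrum is known only through the factorised
-- characteristic polynomial, so eigenvectors are not at hand. What the factorisation supplies, for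
-- every t, is the value of det (t - L), and Cramer's rule makes that a quantitative injectivity of
-- t - L. Since `≤` is the negation of `<`, each bound on an eigenvalue is proved by refuting its
-- strict violation, and the violation itself is the strict separation that the steps need. At the
-- lower end one eigenvalue, the last, is exempt from the assumed bound, yet it too must stay away
-- from the interval swept by t. As L annihilates the constants, not all eigenvalues are apart from
-- 0; the others being positive, the exempt one is 0. The vector for the degree bound comes from D =
-- 2(J - I) - A, with A the adjacency matrix, valid in diameter two: on zero-sum vectors L is 2n
-- minus the ordinary Laplacian of the graph. The latter dominates the Laplacian of the star at v,
-- of which the vector is an eigenvector with eigenvalue Δ + 1.

-- Integer coefficients for the ring solver.

module IntegerCoefficients {c ℓ : Level} (R : CommutativeRing c ℓ) where
  open CommutativeRing R hiding (zero)
  open AbelianGroupProperties +-abelianGroup using (⁻¹-∙-comm)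
  open GroupProperties +-group using (⁻¹-involutive; ε⁻¹≈ε)
  open RingProperties ring using (-‿distribˡ-*; -‿distribʳ-*)
  open TCOptimisedMultProperties semiring using (×-homo-+; ×1-homo-*; 1+×) renaming (_×_ to _·_)
  open CommutativeSemigroupProperties *-commutativeSemigroup using (interchange)
  open CommutativeSemigroupProperties +-commutativeSemigroup
    using () renaming (interchange to +-interchange)
  open SetoidReasoning setoid

  -- With the optimised multiples the coefficient 1 evaluates to `1#` itself rather than to a sum
  -- with `0#`, so solved equations match goals that mention `1#`.
  fromℤ : ℤ → Carrier
  fromℤ (ℤ.+ n)  = n · 1#
  fromℤ -[1+ n ] = - (suc n · 1#)

  fromℤ-neg : ∀ i → fromℤ (ℤ.- i) ≈ - fromℤ i
  fromℤ-neg (ℤ.+ zero)  = sym ε⁻¹≈ε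
  fromℤ-neg (ℤ.+ suc n) = refl
  fromℤ-neg -[1+ n ]    = sym (⁻¹-involutive _)

  fromℤ-⊖ : ∀ m n → fromℤ (m ⊖ n) ≈ m · 1# - n · 1#
  fromℤ-⊖ zero    zero    = sym (-‿inverseʳ 0#)
  fromℤ-⊖ zero    (suc n) = sym (+-identityˡ _)
  fromℤ-⊖ (suc m) zero    = sym (trans (+-congˡ ε⁻¹≈ε) (+-identityʳ _))
  fromℤ-⊖ (suc m) (suc n) = begin
    fromℤ (suc m ⊖ suc n)            ≡⟨ ≡.cong fromℤ (ℤ.[1+m]⊖[1+n]≡m⊖n m n) ⟩
    fromℤ (m ⊖ n)                    ≈⟨ fromℤ-⊖ m n ⟩
    m · 1# - n · 1#                  ≈⟨ +-identityˡ _ ⟨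
    0# + (m · 1# - n · 1#)           ≈⟨ +-congʳ (-‿inverseʳ 1#) ⟨
    1# - 1# + (m · 1# - n · 1#)      ≈⟨ +-interchange _ _ _ _ ⟩
    1# + m · 1# + (- 1# - n · 1#)    ≈⟨ +-congˡ (⁻¹-∙-comm _ _) ⟩
    1# + m · 1# - (1# + n · 1#)      ≈⟨ +-cong (1+× m 1#) (-‿cong (1+× n 1#)) ⟨
    suc m · 1# - suc n · 1#          ∎

  fromℤ-+ : ∀ i j → fromℤ (i ℤ.+ j) ≈ fromℤ i + fromℤ j
  fromℤ-+ (ℤ.+ m)  (ℤ.+ n)  = ×-homo-+ 1# m n
  fromℤ-+ (ℤ.+ m)  -[1+ n ] = fromℤ-⊖ m (suc n)
  fromℤ-+ -[1+ m ] (ℤ.+ n)  = trans (fromℤ-⊖ n (suc m)) (+-comm _ _)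
  fromℤ-+ -[1+ m ] -[1+ n ] = begin
    - (suc (suc (m ℕ.+ n)) · 1#)     ≡⟨ ≡.cong (λ k → - (k · 1#)) (≡.sym (ℕ.+-suc (suc m) n)) ⟩
    - ((suc m ℕ.+ suc n) · 1#)       ≈⟨ -‿cong (×-homo-+ 1# (suc m) (suc n)) ⟩
    - (suc m · 1# + suc n · 1#)      ≈⟨ ⁻¹-∙-comm _ _ ⟨
    - (suc m · 1#) - suc n · 1#      ∎

  fromSign : Sign → Carrier
  fromSign Sign.+ = 1#
  fromSign Sign.- = - 1#

  fromSign-* : ∀ s t → fromSign (s Sign.* t) ≈ fromSign s * fromSign t
  fromSign-* Sign.+ t      = sym (*-identityˡ _)
  fromSign-* Sign.- Sign.+ = sym (*-identityʳ _)
  fromSign-* Sign.- Sign.- = begin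
    1#              ≈⟨ ⁻¹-involutive _ ⟨
    - - 1#          ≈⟨ -‿cong (*-identityʳ _) ⟨
    - (- 1# * 1#)   ≈⟨ -‿distribʳ-* _ _ ⟩
    - 1# * - 1#     ∎

  fromℤ-◃ : ∀ s n → fromℤ (s ◃ n) ≈ fromSign s * (n · 1#)
  fromℤ-◃ s      zero    = sym (zeroʳ _)
  fromℤ-◃ Sign.+ (suc n) = sym (*-identityˡ _)
  fromℤ-◃ Sign.- (suc n) = trans (-‿cong (sym (*-identityˡ _))) (-‿distribˡ-* _ _)

  fromℤ-sign : ∀ i → fromℤ i ≈ fromSign (ℤ.sign i) * (ℤ.∣ i ∣ · 1#)
  fromℤ-sign i = trans (reflexive (≡.cong fromℤ (≡.sym (ℤ.◃-inverse i))))
                       (fromℤ-◃ (ℤ.sign i) ℤ.∣ i ∣)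

  fromℤ-* : ∀ i j → fromℤ (i ℤ.* j) ≈ fromℤ i * fromℤ j
  fromℤ-* i j = begin
    fromℤ (s Sign.* t ◃ m ℕ.* n)                         ≈⟨ fromℤ-◃ (s Sign.* t) (m ℕ.* n) ⟩
    fromSign (s Sign.* t) * ((m ℕ.* n) · 1#)             ≈⟨ *-cong (fromSign-* s t) (×1-homo-* m n) ⟩
    (fromSign s * fromSign t) * ((m · 1#) * (n · 1#))    ≈⟨ interchange _ _ _ _ ⟩
    (fromSign s * (m · 1#)) * (fromSign t * (n · 1#))    ≈⟨ *-cong (fromℤ-sign i) (fromℤ-sign j) ⟨
    fromℤ i * fromℤ j                                    ∎
    where
    s = ℤ.sign i
    t = ℤ.sign j
    m = ℤ.∣ i ∣
    n = ℤ.∣ j ∣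

  fromℤ-homomorphism : ℤ.+-*-rawRing -Raw-AlmostCommutative⟶ fromCommutativeRing R
  fromℤ-homomorphism = record
    { ⟦_⟧    = fromℤ
    ; +-homo = fromℤ-+
    ; *-homo = fromℤ-*
    ; -‿homo = fromℤ-neg
    ; 0-homo = refl
    ; 1-homo = refl
    }

  fromℤ-≟ : WeaklyDecidable (λ i j → fromℤ i ≈ fromℤ j)
  fromℤ-≟ i j with i ℤ.≟ j
  ... | yes i≡j = just (reflexive (≡.cong fromℤ i≡j))
  ... | no  _   = nothing

  module Solver = Algebra.Solver.Ring
    ℤ.+-*-rawRing (fromCommutativeRing R) fromℤ-homomorphism fromℤ-≟

-- Order arithmetic in a constructive ordered field.

module OrderedField {c ℓ₁ ℓ₂ ℓ₃ : Level} (ℝ : RealField c ℓ₁ ℓ₂ ℓ₃) where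
  open RealField ℝ hiding (zero)
  open IntegerCoefficients commutativeRing public using (module Solver)
  open Solver
  open IsStrictPartialOrder <-isStrictPartialOrder public
    using (<-resp-≈; <-respʳ-≈)
    renaming (irrefl to <-irrefl; trans to <-trans; asym to <-asym)

  -- Excluded middle is admissible when the goal is a negation. As `≤` is one, inequalities may be
  -- proved by splitting on undecidable propositions.
  by-cases : ∀ {a b} {A : Set a} {B : Set b} → (A → ¬ B) → (¬ A → ¬ B) → ¬ B
  by-cases f g b = g (λ a → f a b) b

  <⇒≤ : ∀ {x y} → x < y → x ≤ y
  <⇒≤ = <-asym

  ≤-reflexive : ∀ {x y} → x ≈ y → x ≤ y
  ≤-reflexive x≈y = <-irrefl (sym x≈y)

  ≤-refl : ∀ {x} → x ≤ x
  ≤-refl = ≤-reflexive refl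

  -- A negated `<` carries no comparison of its own. Cotransitivity of apartness supplies one, of z
  -- with x or with y, and `y≤z` refutes the wrong outcomes.
  <-≤-trans : ∀ {x y z} → x < y → y ≤ z → x < z
  <-≤-trans {z = z} x<y y≤z with #-cotrans (<⇒# x<y) z
  ... | inj₁ x#z with #⇒<⊎> x#z
  ...   | inj₁ x<z = x<z
  ...   | inj₂ z<x = contradiction (<-trans z<x x<y) y≤z
  <-≤-trans {z = z} x<y y≤z | inj₂ z#y with #⇒<⊎> z#y
  ...   | inj₁ z<y = contradiction z<y y≤z
  ...   | inj₂ y<z = <-trans x<y y<z

  ≤-<-trans : ∀ {x y z} → x ≤ y → y < z → x < z
  ≤-<-trans {x} x≤y y<z with #-cotrans (<⇒# y<z) x
  ... | inj₁ y#x with #⇒<⊎> y#x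
  ...   | inj₁ y<x = contradiction y<x x≤y
  ...   | inj₂ x<y = <-trans x<y y<z
  ≤-<-trans {x} x≤y y<z | inj₂ x#z with #⇒<⊎> x#z
  ...   | inj₁ x<z = x<z
  ...   | inj₂ z<x = contradiction (<-trans y<z z<x) x≤y

  ≤-trans : ∀ {x y z} → x ≤ y → y ≤ z → x ≤ z
  ≤-trans x≤y y≤z z<x = x≤y (≤-<-trans y≤z z<x)

  ≤-isPreorder : IsPreorder _≈_ _≤_
  ≤-isPreorder = record
    { isEquivalence = isEquivalence ; reflexive = ≤-reflexive ; trans = ≤-trans }

  module ≤-Reasoning = TripleReasoning
    ≤-isPreorder <-asym <-trans <-resp-≈ <⇒≤ <-≤-trans ≤-<-trans
    hiding (step-≡; step-≡-∣; step-≡-⟩; step-≡-⟨)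
  open ≤-Reasoning

  ≤-antisym : ∀ {x y} → x ≤ y → y ≤ x → x ≈ y
  ≤-antisym x≤y y≤x = proj₁ (tight _ _) ([ y≤x , x≤y ] ∘ #⇒<⊎>)

  +-monoˡ-≤ : ∀ z {x y} → x ≤ y → x + z ≤ y + z
  +-monoˡ-≤ z {x} {y} x≤y y+z<x+z = x≤y (begin-strict
    y              ≈⟨ solve 2 (λ y z → y := y :+ z :- z) refl y z ⟩
    y + z - z      <⟨ +-monoˡ-< (- z) y+z<x+z ⟩
    x + z - z      ≈⟨ solve 2 (λ y z → y :+ z :- z := y) refl x z ⟩
    x              ∎)

  +-mono-≤ : ∀ {x y u v} → x ≤ y → u ≤ v → x + u ≤ y + v
  +-mono-≤ {x} {y} {u} {v} x≤y u≤v = begin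
    x + u   ≤⟨ +-monoˡ-≤ u x≤y ⟩
    y + u   ≈⟨ +-comm y u ⟩
    u + y   ≤⟨ +-monoˡ-≤ y u≤v ⟩
    v + y   ≈⟨ +-comm v y ⟩
    y + v   ∎

  +-nonNeg : ∀ {x y} → 0# ≤ x → 0# ≤ y → 0# ≤ x + y
  +-nonNeg {x} {y} 0≤x 0≤y = begin
    0#        ≈⟨ +-identityˡ 0# ⟨
    0# + 0#   ≤⟨ +-mono-≤ 0≤x 0≤y ⟩
    x + y     ∎

  +-pos-nonNeg : ∀ {x y} → 0# < x → 0# ≤ y → 0# < x + y
  +-pos-nonNeg {x} {y} 0<x 0≤y = begin-strict
    0#        <⟨ 0<x ⟩
    x         ≈⟨ +-identityʳ x ⟨
    x + 0#    ≤⟨ +-mono-≤ ≤-refl 0≤y ⟩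
    x + y     ∎

  x≤y⇒0≤y-x : ∀ {x y} → x ≤ y → 0# ≤ y - x
  x≤y⇒0≤y-x {x} {y} x≤y = begin
    0#      ≈⟨ -‿inverseʳ x ⟨
    x - x   ≤⟨ +-monoˡ-≤ (- x) x≤y ⟩
    y - x   ∎

  0≤y-x⇒x≤y : ∀ {x y} → 0# ≤ y - x → x ≤ y
  0≤y-x⇒x≤y {x} {y} 0≤y-x = begin
    x            ≈⟨ +-identityˡ x ⟨
    0# + x       ≤⟨ +-monoˡ-≤ x 0≤y-x ⟩
    y - x + x    ≈⟨ solve 2 (λ x y → y :- x :+ x := y) refl x y ⟩
    y            ∎

  x<y⇒0<y-x : ∀ {x y} → x < y → 0# < y - x
  x<y⇒0<y-x {x} {y} x<y = begin-strict
    0#      ≈⟨ -‿inverseʳ x ⟨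
    x - x   <⟨ +-monoˡ-< (- x) x<y ⟩
    y - x   ∎

  0<y-x⇒x<y : ∀ {x y} → 0# < y - x → x < y
  0<y-x⇒x<y {x} {y} 0<y-x = begin-strict
    x            ≈⟨ +-identityˡ x ⟨
    0# + x       <⟨ +-monoˡ-< x 0<y-x ⟩
    y - x + x    ≈⟨ solve 2 (λ x y → y :- x :+ x := y) refl x y ⟩
    y            ∎

  x<0⇒0<-x : ∀ {x} → x < 0# → 0# < - x
  x<0⇒0<-x x<0 = <-respʳ-≈ (+-identityˡ _) (x<y⇒0<y-x x<0)

  ≤-by : ∀ {x y d} → 0# ≤ d → y - x ≈ d → x ≤ y
  ≤-by 0≤d y-x≈d = 0≤y-x⇒x≤y (≤-trans 0≤d (≤-reflexive (sym y-x≈d)))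

  ≰⇒≥ : ∀ {x y} → ¬ (x ≤ y) → y ≤ x
  ≰⇒≥ x≰y x<y = x≰y (<⇒≤ x<y)

  ¬#0⇒≈0 : ∀ {x} → ¬ (x # 0#) → x ≈ 0#
  ¬#0⇒≈0 = proj₁ (tight _ _)

  square-pos : ∀ {x} → x # 0# → 0# < x * x
  square-pos {x} x#0 with #⇒<⊎> x#0
  ... | inj₁ x<0 = <-respʳ-≈ (solve 1 (λ x → :- x :* :- x := x :* x) refl x)
                     (*-positive (x<0⇒0<-x x<0) (x<0⇒0<-x x<0))
  ... | inj₂ 0<x = *-positive 0<x 0<x

  square-nonNeg : ∀ x → 0# ≤ x * x
  square-nonNeg x = by-cases (<-asym ∘ square-pos) λ ¬x#0 x*x<0 →
    <-irrefl (trans (*-congʳ (¬#0⇒≈0 ¬x#0)) (zeroˡ x)) x*x<0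

  *-nonNeg : ∀ {x y} → 0# ≤ x → 0# ≤ y → 0# ≤ x * y
  *-nonNeg {x} {y} 0≤x 0≤y = by-cases
    (λ 0<x → by-cases (<-asym ∘ *-positive 0<x)
      λ ¬0<y → <-irrefl (trans (*-congˡ (≤-antisym ¬0<y 0≤y)) (zeroʳ x)))
    λ ¬0<x → <-irrefl (trans (*-congʳ (≤-antisym ¬0<x 0≤x)) (zeroˡ y))

  0<1 : 0# < 1#
  0<1 = <-respʳ-≈ (*-identityˡ 1#) (square-pos (1#0 heytingCommutativeRing))

  0≤1 : 0# ≤ 1#
  0≤1 = <⇒≤ 0<1

  *-monoˡ-≤ : ∀ {z x y} → 0# ≤ z → x ≤ y → z * x ≤ z * y
  *-monoˡ-≤ {z} {x} {y} 0≤z x≤y = ≤-by (*-nonNeg 0≤z (x≤y⇒0≤y-x x≤y))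
    (solve 3 (λ x y z → z :* y :- z :* x := z :* (y :- x)) refl x y z)

  *-monoʳ-≤ : ∀ {z x y} → 0# ≤ z → x ≤ y → x * z ≤ y * z
  *-monoʳ-≤ {z} {x} {y} 0≤z x≤y = ≤-by (*-nonNeg 0≤z (x≤y⇒0≤y-x x≤y))
    (solve 3 (λ x y z → y :* z :- x :* z := z :* (y :- x)) refl x y z)

  *-mono-≤ : ∀ {x y u v} → 0# ≤ x → 0# ≤ v → x ≤ y → u ≤ v → x * u ≤ y * v
  *-mono-≤ 0≤x 0≤v x≤y u≤v = ≤-trans (*-monoˡ-≤ 0≤x u≤v) (*-monoʳ-≤ 0≤v x≤y)

  *-cancelˡ-nonNeg : ∀ {z x} → 0# < z → 0# ≤ z * x → 0# ≤ x
  *-cancelˡ-nonNeg {z} {x} 0<z 0≤zx x<0 = 0≤zx (0<y-x⇒x<y (<-respʳ-≈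
    (solve 2 (λ x z → z :* :- x := con (ℤ.+ 0) :- z :* x) refl x z)
    (*-positive 0<z (x<0⇒0<-x x<0))))

  *-cancelˡ-≤ : ∀ {z x y} → 0# < z → z * x ≤ z * y → x ≤ y
  *-cancelˡ-≤ {z} {x} {y} 0<z zx≤zy = 0≤y-x⇒x≤y (*-cancelˡ-nonNeg 0<z
    (≤-trans (x≤y⇒0≤y-x zx≤zy)
      (≤-reflexive (solve 3 (λ x y z → z :* y :- z :* x := z :* (y :- x)) refl x y z))))

  square-mono-≤ : ∀ {x y} → 0# ≤ x → x ≤ y → x * x ≤ y * y
  square-mono-≤ 0≤x x≤y = *-mono-≤ 0≤x (≤-trans 0≤x x≤y) x≤y x≤y

  inverse-pos : ∀ {x} → 0# < x → ∃ λ y → 0# < y × x * y ≈ 1#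
  inverse-pos {x} 0<x with #⇒invertible (#-sym (<⇒# 0<x))
  ... | y , _ , [x-0]y≈1 = y , 0<y , xy≈1
    where
    xy≈1 : x * y ≈ 1#
    xy≈1 = trans (solve 2 (λ x y → x :* y := (x :- con (ℤ.+ 0)) :* y) refl x y) [x-0]y≈1
    -- From xy = 1 follows y = x y², a product of positives once y is known to be apart from 0.
    0<y : 0# < y
    0<y = begin-strict
      0#             <⟨ *-positive 0<x (square-pos y#0) ⟩
      x * (y * y)    ≈⟨ *-assoc x y y ⟨
      x * y * y      ≈⟨ *-congʳ xy≈1 ⟩
      1# * y         ≈⟨ *-identityˡ y ⟩
      y              ∎
      where
      y#0 : y # 0#
      y#0 = invertible⇒# (x , trans (*-congˡ (solve 1 (λ y → y :- con (ℤ.+ 0) := y) refl y)) xy≈1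
                            , trans (solve 2 (λ x y → (y :- con (ℤ.+ 0)) :* x := x :* y) refl x y) xy≈1)

  fromNat-nonNeg : ∀ k → 0# ≤ fromNat k
  fromNat-nonNeg zero    = ≤-refl
  fromNat-nonNeg (suc k) = +-nonNeg 0≤1 (fromNat-nonNeg k)

  fromNat-pos : ∀ k → 0# < fromNat (suc k)
  fromNat-pos k = +-pos-nonNeg 0<1 (fromNat-nonNeg k)

  fromNat-mono-≤ : ∀ {j k} → j ℕ.≤ k → fromNat j ≤ fromNat k
  fromNat-mono-≤ {k = k} ℕ.z≤n = fromNat-nonNeg k
  fromNat-mono-≤ (ℕ.s≤s j≤k)   = +-mono-≤ ≤-refl (fromNat-mono-≤ j≤k)

-- Sums, inner products and the descent for quadratic forms.

module LinearAlgebra {c ℓ₁ ℓ₂ ℓ₃ : Level} (ℝ : RealField c ℓ₁ ℓ₂ ℓ₃) where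
  open RealField ℝ hiding (zero)
  open Spectra ℝ
  open OrderedField ℝ public
  open Solver
  open SumProperties semiring public
    using (sum-cong-≋; ∑-distrib-+; ∑-comm; *-distribˡ-sum; *-distribʳ-sum; sum-replicate-zero)
  open MultProperties semiring public using (×-homo-+)
  open SetoidReasoning setoid

  private variable
    n : ℕ

  infixr 9 _⊛_
  infix  8 _∙_

  -- The common linearity lemma for sums. Many expressions below carry explicit factors `1#` and
  -- `- 1#` so that they have this shape.
  sum-combination : ∀ a b (f g : Vector Carrier n) →
    sum (λ i → a * f i + b * g i) ≈ a * sum f + b * sum g
  sum-combination a b f g = begin
    sum (λ i → a * f i + b * g i)                ≈⟨ ∑-distrib-+ (λ i → a * f i) (λ i → b * g i) ⟩
    sum (λ i → a * f i) + sum (λ i → b * g i)    ≈⟨ +-cong (*-distribˡ-sum a f) (*-distribˡ-sum b g) ⟨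
    a * sum f + b * sum g                        ∎

  sum-const : ∀ n x → sum {n} (λ _ → x) ≈ fromNat n * x
  sum-const zero    x = sym (zeroˡ x)
  sum-const (suc n) x = begin
    x + sum {n} (λ _ → x)    ≈⟨ +-congˡ (sum-const n x) ⟩
    x + fromNat n * x        ≈⟨ solve 2 (λ k x → x :+ k :* x := (con (ℤ.+ 1) :+ k) :* x) refl (fromNat n) x ⟩
    fromNat (suc n) * x      ∎

  sum-zero : ∀ {f : Vector Carrier n} → (∀ i → f i ≈ 0#) → sum f ≈ 0#
  sum-zero {n} f≈0 = trans (sum-cong-≋ f≈0) (sum-replicate-zero n)

  sum-mono-≤ : ∀ {f g : Vector Carrier n} → (∀ i → f i ≤ g i) → sum f ≤ sum g
  sum-mono-≤ {zero}  f≤g = ≤-refl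
  sum-mono-≤ {suc n} f≤g = +-mono-≤ (f≤g zero) (sum-mono-≤ (f≤g ∘ suc))

  sum-nonNeg : ∀ {f : Vector Carrier n} → (∀ i → 0# ≤ f i) → 0# ≤ sum f
  sum-nonNeg {n} 0≤f = ≤-trans (≤-reflexive (sym (sum-replicate-zero n))) (sum-mono-≤ 0≤f)

  _∙_ : Vector Carrier n → Vector Carrier n → Carrier
  x ∙ y = sum λ i → x i * y i

  ∥_∥² : Vector Carrier n → Carrier
  ∥ x ∥² = x ∙ x

  _⊛_ : Matrix n → Vector Carrier n → Vector Carrier n
  (A ⊛ x) i = A i ∙ x

  ∙-congʳ : ∀ (x : Vector Carrier n) {u v} → (∀ i → u i ≈ v i) → x ∙ u ≈ x ∙ v
  ∙-congʳ x u≈v = sum-cong-≋ λ i → *-congˡ {x i} (u≈v i)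

  ∙-congˡ : ∀ (x : Vector Carrier n) {u v} → (∀ i → u i ≈ v i) → u ∙ x ≈ v ∙ x
  ∙-congˡ x u≈v = sum-cong-≋ λ i → *-congʳ {x i} (u≈v i)

  ∙-comm : ∀ (x y : Vector Carrier n) → x ∙ y ≈ y ∙ x
  ∙-comm x y = sum-cong-≋ λ i → *-comm (x i) (y i)

  ∙-combinationʳ : ∀ a b (x y z : Vector Carrier n) →
    x ∙ (λ i → a * y i + b * z i) ≈ a * (x ∙ y) + b * (x ∙ z)
  ∙-combinationʳ a b x y z = trans
    (sum-cong-≋ λ i → solve 5 (λ a b x y z → x :* (a :* y :+ b :* z) := a :* (x :* y) :+ b :* (x :* z))
                        refl a b (x i) (y i) (z i))
    (sum-combination a b (λ i → x i * y i) (λ i → x i * z i))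

  ∙-combinationˡ : ∀ a b (x y z : Vector Carrier n) →
    (λ i → a * y i + b * z i) ∙ x ≈ a * (y ∙ x) + b * (z ∙ x)
  ∙-combinationˡ a b x y z = begin
    (λ i → a * y i + b * z i) ∙ x    ≈⟨ ∙-comm _ x ⟩
    x ∙ (λ i → a * y i + b * z i)    ≈⟨ ∙-combinationʳ a b x y z ⟩
    a * (x ∙ y) + b * (x ∙ z)        ≈⟨ +-cong (*-congˡ (∙-comm x y)) (*-congˡ (∙-comm x z)) ⟩
    a * (y ∙ x) + b * (z ∙ x)        ∎

  ∥∥²-nonNeg : ∀ (x : Vector Carrier n) → 0# ≤ ∥ x ∥²
  ∥∥²-nonNeg x = sum-nonNeg (square-nonNeg ∘ x)

  SymmetricMatrix : Matrix n → Set ℓ₁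
  SymmetricMatrix A = ∀ i j → A i j ≈ A j i

  ⊛-selfAdjoint : ∀ {A : Matrix n} → SymmetricMatrix A → ∀ x y → x ∙ A ⊛ y ≈ (A ⊛ x) ∙ y
  ⊛-selfAdjoint {A = A} A-sym x y = begin
    sum (λ i → x i * sum λ j → A i j * y j)
      ≈⟨ sum-cong-≋ (λ i → *-distribˡ-sum (x i) λ j → A i j * y j) ⟩
    sum (λ i → sum λ j → x i * (A i j * y j))        ≈⟨ ∑-comm (λ i j → x i * (A i j * y j)) ⟩
    sum (λ j → sum λ i → x i * (A i j * y j))
      ≈⟨ sum-cong-≋ (λ j → sum-cong-≋ λ i → trans (sym (*-assoc _ _ _)) (*-congʳ (trans (*-comm _ _) (*-congʳ (A-sym i j))))) ⟩
    sum (λ j → sum λ i → A j i * x i * y j)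
      ≈⟨ sum-cong-≋ (λ j → *-distribʳ-sum (y j) λ i → A j i * x i) ⟨
    sum (λ j → sum (λ i → A j i * x i) * y j)        ∎

  -- Adding s rather than subtracting it lets one descent serve both ends of the spectrum: -L
  -- shifted by t is t - L, and L shifted by -t is L - t.
  shift : Matrix n → Carrier → Vector Carrier n → Vector Carrier n
  shift A s x i = (A ⊛ x) i + s * x i

  form : Matrix n → Carrier → Vector Carrier n → Carrier
  form A s x = x ∙ shift A s x

  module _ {A : Matrix n} where

    form-expand : ∀ s x → form A s x ≈ x ∙ A ⊛ x + s * ∥ x ∥²
    form-expand s x = begin
      x ∙ shift A s x                        ≈⟨ ∙-congʳ x (λ i → +-congʳ (sym (*-identityˡ _))) ⟩
      x ∙ (λ i → 1# * (A ⊛ x) i + s * x i)   ≈⟨ ∙-combinationʳ 1# s x (A ⊛ x) x ⟩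
      1# * (x ∙ A ⊛ x) + s * ∥ x ∥²          ≈⟨ +-congʳ (*-identityˡ _) ⟩
      x ∙ A ⊛ x + s * ∥ x ∥²                 ∎

    form-shift : ∀ s t x → form A t x ≈ form A s x + (t - s) * ∥ x ∥²
    form-shift s t x = begin
      form A t x                                        ≈⟨ form-expand t x ⟩
      x ∙ A ⊛ x + t * ∥ x ∥²
        ≈⟨ solve 4 (λ q n s t → q :+ t :* n := q :+ s :* n :+ (t :- s) :* n) refl (x ∙ A ⊛ x) ∥ x ∥² s t ⟩
      x ∙ A ⊛ x + s * ∥ x ∥² + (t - s) * ∥ x ∥²         ≈⟨ +-congʳ (form-expand s x) ⟨
      form A s x + (t - s) * ∥ x ∥²                     ∎

    form-mono-≤ : ∀ {s t} → s ≤ t → ∀ x → form A s x ≤ form A t x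
    form-mono-≤ {s} {t} s≤t x = ≤-by (*-nonNeg (x≤y⇒0≤y-x s≤t) (∥∥²-nonNeg x))
      (trans (+-congʳ (form-shift s t x)) (solve 2 (λ a b → a :+ b :- a := b) refl (form A s x) ((t - s) * ∥ x ∥²)))

    shift-combination : ∀ s a b x y i →
      shift A s (λ i → a * x i + b * y i) i ≈ a * shift A s x i + b * shift A s y i
    shift-combination s a b x y i = begin
      A i ∙ (λ i → a * x i + b * y i) + s * (a * x i + b * y i)    ≈⟨ +-congʳ (∙-combinationʳ a b (A i) x y) ⟩
      a * (A i ∙ x) + b * (A i ∙ y) + s * (a * x i + b * y i)
        ≈⟨ solve 7 (λ a b s p q x y → a :* p :+ b :* q :+ s :* (a :* x :+ b :* y)
                                     := a :* (p :+ s :* x) :+ b :* (q :+ s :* y))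
             refl a b s (A i ∙ x) (A i ∙ y) (x i) (y i) ⟩
      a * shift A s x i + b * shift A s y i                        ∎

    module _ (A-sym : SymmetricMatrix A) where

      shift-selfAdjoint : ∀ s x y → x ∙ shift A s y ≈ shift A s x ∙ y
      shift-selfAdjoint s x y = begin
        x ∙ shift A s y                                  ≈⟨ ∙-congʳ x (λ i → +-congʳ (sym (*-identityˡ _))) ⟩
        x ∙ (λ i → 1# * (A ⊛ y) i + s * y i)             ≈⟨ ∙-combinationʳ 1# s x (A ⊛ y) y ⟩
        1# * (x ∙ A ⊛ y) + s * (x ∙ y)                   ≈⟨ +-congʳ (*-congˡ (⊛-selfAdjoint A-sym x y)) ⟩
        1# * ((A ⊛ x) ∙ y) + s * (x ∙ y)                 ≈⟨ ∙-combinationˡ 1# s y (A ⊛ x) x ⟨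
        (λ i → 1# * (A ⊛ x) i + s * x i) ∙ y             ≈⟨ ∙-congˡ y (λ i → +-congʳ (*-identityˡ _)) ⟩
        shift A s x ∙ y                                  ∎

      -- Both cross terms equal the squared norm of y by self-adjointness. Adding T times that norm
      -- lets an upper bound on the form at y cancel, so positivity of the form at T x - y yields
      -- the bound on the squared norm of y.
      form-residual : ∀ s T x → let y = shift A s x in
        form A s (λ i → T * x i + - 1# * y i) + T * ∥ y ∥² ≈ T * (T * form A s x - ∥ y ∥²) + form A s y
      form-residual s T x = trans (+-congʳ expand)
        (solve 4 (λ T q m r → T :* (T :* q :+ :- con (ℤ.+ 1) :* m) :+ :- con (ℤ.+ 1) :* (T :* m :+ :- con (ℤ.+ 1) :* r) :+ T :* m
                            := T :* (T :* q :- m) :+ r)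
           refl T (form A s x) ∥ y ∥² (form A s y))
        where
        y z : Vector Carrier n
        y = shift A s x
        z i = T * x i + - 1# * y i
        expand : form A s z ≈ T * (T * form A s x + - 1# * ∥ y ∥²) + - 1# * (T * ∥ y ∥² + - 1# * form A s y)
        expand = begin
          z ∙ shift A s z
            ≈⟨ ∙-congʳ z (shift-combination s T (- 1#) x y) ⟩
          z ∙ (λ i → T * y i + - 1# * shift A s y i)
            ≈⟨ ∙-combinationˡ T (- 1#) (λ i → T * y i + - 1# * shift A s y i) x y ⟩
          T * (x ∙ (λ i → T * y i + - 1# * shift A s y i)) + - 1# * (y ∙ (λ i → T * y i + - 1# * shift A s y i))
            ≈⟨ +-cong (*-congˡ (∙-combinationʳ T (- 1#) x y (shift A s y))) (*-congˡ (∙-combinationʳ T (- 1#) y y (shift A s y))) ⟩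
          T * (T * form A s x + - 1# * (x ∙ shift A s y)) + - 1# * (T * ∥ y ∥² + - 1# * form A s y)
            ≈⟨ +-congʳ (*-congˡ (+-congˡ (*-congˡ (shift-selfAdjoint s x y)))) ⟩
          T * (T * form A s x + - 1# * ∥ y ∥²) + - 1# * (T * ∥ y ∥² + - 1# * form A s y) ∎

      module _ (rowSums : ∀ i → sum (A i) ≈ 0#) where

        -- Constant vectors are eigenvectors by `rowSums`, so a self-adjoint operator preserves
        -- their orthogonal complement. Hence the bounds assumed for zero-sum vectors may be applied
        -- to the shifted vector again.
        shift-sum : ∀ s {x} → sum x ≈ 0# → sum (shift A s x) ≈ 0#
        shift-sum s {x} ∑x≈0 = begin
          sum (λ i → (A ⊛ x) i + s * x i)            ≈⟨ sum-cong-≋ (λ i → *-identityˡ (shift A s x i)) ⟨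
          (λ _ → 1#) ∙ shift A s x                   ≈⟨ shift-selfAdjoint s (λ _ → 1#) x ⟩
          shift A s (λ _ → 1#) ∙ x
            ≈⟨ ∙-congˡ x (λ i → +-congʳ (trans (sum-cong-≋ λ j → *-identityʳ (A i j)) (rowSums i))) ⟩
          sum (λ i → (0# + s * 1#) * x i)            ≈⟨ *-distribˡ-sum (0# + s * 1#) x ⟨
          (0# + s * 1#) * sum x                      ≈⟨ *-congˡ ∑x≈0 ⟩
          (0# + s * 1#) * 0#                         ≈⟨ zeroʳ _ ⟩
          0#                                         ∎

        -- Positivity of the form at T x − (A + s) x.
        ∥shift∥²≤ : ∀ {s T} → 0# < T →
          (∀ {x} → sum x ≈ 0# → form A s x ≤ T * ∥ x ∥²) →
          (∀ {x} → sum x ≈ 0# → 0# ≤ form A s x) →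
          ∀ {x} → sum x ≈ 0# → ∥ shift A s x ∥² ≤ T * form A s x
        ∥shift∥²≤ {s} {T} 0<T upper psd {x} ∑x≈0 = 0≤y-x⇒x≤y (*-cancelˡ-nonNeg 0<T
          (≤-by (+-nonNeg (psd ∑z≈0) (x≤y⇒0≤y-x (upper ∑y≈0)))
            (trans
              (solve 3 (λ a b c → a :- con (ℤ.+ 0) := a :+ b :- b) refl (T * (T * form A s x - ∥ y ∥²)) (form A s y) 0#)
              (trans (+-congʳ (sym (form-residual s T x)))
                (solve 3 (λ p q r → p :+ q :- r := p :+ (q :- r)) refl (form A s z) (T * ∥ y ∥²) (form A s y))))))
          where
          y z : Vector Carrier n
          y = shift A s x
          z i = T * x i + - 1# * y i
          ∑y≈0 : sum y ≈ 0#
          ∑y≈0 = shift-sum s ∑x≈0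
          ∑z≈0 : sum z ≈ 0#
          ∑z≈0 = begin
            sum z                       ≈⟨ sum-combination T (- 1#) x y ⟩
            T * sum x + - 1# * sum y    ≈⟨ +-cong (*-congˡ ∑x≈0) (*-congˡ ∑y≈0) ⟩
            T * 0# + - 1# * 0#
              ≈⟨ solve 1 (λ t → t :* con (ℤ.+ 0) :+ :- con (ℤ.+ 1) :* con (ℤ.+ 0) := con (ℤ.+ 0)) refl T ⟩
            0#                          ∎

        -- While A + s is coercive, positivity of its form propagates from s to
        -- s − δ / T, a step of fixed length, so finitely many steps lead from hi to lo.
        descent : ∀ {lo hi T δ} → lo ≤ hi → 0# < T → 0# < δ →
          (∀ {x} → sum x ≈ 0# → form A hi x ≤ T * ∥ x ∥²) →
          (∀ {x} → sum x ≈ 0# → 0# ≤ form A hi x) →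
          (∀ {s} → lo ≤ s → s ≤ hi → ∀ {x} → sum x ≈ 0# → δ * ∥ x ∥² ≤ ∥ shift A s x ∥²) →
          ∀ {x} → sum x ≈ 0# → δ * ∥ x ∥² ≤ T * form A lo x
        descent {lo} {hi} {T} {δ} lo≤hi 0<T 0<δ upper psd coercive = gap ≤-refl lo≤hi (reach k ≤-refl hi≤lo+kh)
          where
          T⁻¹ = proj₁ (inverse-pos 0<T)
          0<T⁻¹ = proj₁ (proj₂ (inverse-pos 0<T))
          TT⁻¹≈1 = proj₂ (proj₂ (inverse-pos 0<T))
          δ⁻¹ = proj₁ (inverse-pos 0<δ)
          δδ⁻¹≈1 = proj₂ (proj₂ (inverse-pos 0<δ))
          h = δ * T⁻¹
          0<h : 0# < h
          0<h = *-positive 0<δ 0<T⁻¹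
          Th≈δ : T * h ≈ δ
          Th≈δ = begin
            T * (δ * T⁻¹)    ≈⟨ solve 3 (λ t d u → t :* (d :* u) := d :* (t :* u)) refl T δ T⁻¹ ⟩
            δ * (T * T⁻¹)    ≈⟨ *-congˡ TT⁻¹≈1 ⟩
            δ * 1#           ≈⟨ *-identityʳ δ ⟩
            δ                ∎

          PSD : Carrier → Set _
          PSD s = ∀ {x} → sum x ≈ 0# → 0# ≤ form A s x

          gap : ∀ {s} → lo ≤ s → s ≤ hi → PSD s → ∀ {x} → sum x ≈ 0# → δ * ∥ x ∥² ≤ T * form A s x
          gap lo≤s s≤hi psd-s {x} ∑x≈0 = ≤-trans (coercive lo≤s s≤hi ∑x≈0)
            (∥shift∥²≤ 0<T (λ {x} ∑x≈0 → ≤-trans (form-mono-≤ s≤hi x) (upper ∑x≈0)) psd-s ∑x≈0)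

          step : ∀ {s} → lo ≤ s → s ≤ hi → PSD s → PSD (s - h)
          step {s} lo≤s s≤hi psd-s {x} ∑x≈0 = ≤-trans
            (x≤y⇒0≤y-x (*-cancelˡ-≤ 0<T (≤-trans
              (≤-reflexive (trans (sym (*-assoc T h _)) (*-congʳ Th≈δ))) (gap lo≤s s≤hi psd-s ∑x≈0))))
            (≤-reflexive (trans
              (solve 4 (λ q h n s → q :- h :* n := q :+ (s :- h :- s) :* n) refl (form A s x) h ∥ x ∥² s)
              (sym (form-shift s (s - h) x))))

          reach : ∀ k {s} → lo ≤ s → hi ≤ s + fromNat k * h → PSD s
          reach zero {s} lo≤s hi≤s {x} ∑x≈0 = ≤-trans (psd ∑x≈0) (form-mono-≤
            (≤-trans hi≤s (≤-reflexive (solve 2 (λ s h → s :+ con (ℤ.+ 0) :* h := s) refl s h))) x)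
          -- The recursion climbs from s towards hi, and positivity comes down by h on each return.
          reach (suc k) {s} lo≤s hi≤s+kh {x} ∑x≈0 = by-cases
            (λ s+h≤hi → ≤-trans (step lo≤s+h s+h≤hi (reach k lo≤s+h hi≤s+h+kh) ∑x≈0)
              (form-mono-≤ (≤-reflexive (solve 2 (λ s h → s :+ h :- h := s) refl s h)) x))
            -- The top is less than one step above s: a step from hi itself lands at hi - h, at or
            -- below s, and the form is monotone in the shift.
            (λ s+h≰hi → ≤-trans (step lo≤hi ≤-refl psd ∑x≈0)
              (form-mono-≤ (≤-by (x≤y⇒0≤y-x (≰⇒≥ s+h≰hi))
                (solve 3 (λ s h t → s :- (t :- h) := s :+ h :- t) refl s h hi)) x))
            where
            lo≤s+h : lo ≤ s + h
            lo≤s+h = ≤-trans lo≤s (≤-by (<⇒≤ 0<h) (solve 2 (λ s h → s :+ h :- s := h) refl s h))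
            hi≤s+h+kh : hi ≤ s + h + fromNat k * h
            hi≤s+h+kh = ≤-trans hi≤s+kh (≤-reflexive
              (solve 3 (λ s h k → s :+ (con (ℤ.+ 1) :+ k) :* h := s :+ h :+ k :* h) refl s h (fromNat k)))

          -- Since (T / δ) h = 1, this many steps of length h cover hi - lo.
          k = proj₁ (archimedean ((hi - lo) * (T * δ⁻¹)))
          hi≤lo+kh : hi ≤ lo + fromNat k * h
          hi≤lo+kh = ≤-by (x≤y⇒0≤y-x (*-monoʳ-≤ (<⇒≤ 0<h) (<⇒≤ (proj₂ (archimedean ((hi - lo) * (T * δ⁻¹)))))))
            (trans
              (solve 4 (λ lo hi kh d → lo :+ kh :- hi := kh :- (hi :- lo) :* con (ℤ.+ 1)) refl lo hi (fromNat k * h) δ)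
              (+-congˡ (-‿cong (sym (begin
                (hi - lo) * (T * δ⁻¹) * (δ * T⁻¹)    ≈⟨ solve 5 (λ a t u d v → a :* (t :* v) :* (d :* u) := a :* ((t :* u) :* (d :* v))) refl (hi - lo) T T⁻¹ δ δ⁻¹ ⟩
                (hi - lo) * (T * T⁻¹ * (δ * δ⁻¹))    ≈⟨ *-congˡ (*-cong TT⁻¹≈1 δδ⁻¹≈1) ⟩
                (hi - lo) * (1# * 1#)                ≈⟨ *-congˡ (*-identityˡ 1#) ⟩
                (hi - lo) * 1#                       ∎)))))

-- Adjacent column indices and their behaviour under deletion.

-- An inductive family rather than an equation between numbers, so that deletion of a column by
-- `punchIn` can be followed by structural recursion.
data Adjacent : ∀ {n} → Fin n → Fin n → Set where
  here  : ∀ {n} → Adjacent {suc (suc n)} zero (suc zero)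
  there : ∀ {n} {k l : Fin n} → Adjacent k l → Adjacent (suc k) (suc l)

toℕ-adjacent : ∀ {n} {k l : Fin n} → Adjacent k l → toℕ l ≡ suc (toℕ k)
toℕ-adjacent here        = ≡.refl
toℕ-adjacent (there adj) = ≡.cong suc (toℕ-adjacent adj)

-- Deleting a column outside an adjacent pair leaves the pair adjacent in the minor. This drives the
-- induction in `det-adjacent`.
punchIn-adjacent⁻¹ : ∀ {n} {k l : Fin (suc n)} → Adjacent k l → ∀ j →
  j ≡ k ⊎ j ≡ l ⊎ ∃₂ λ k′ l′ → Adjacent k′ l′ × punchIn j k′ ≡ k × punchIn j l′ ≡ l
punchIn-adjacent⁻¹ here zero = inj₁ ≡.refl
punchIn-adjacent⁻¹ here (suc zero) = inj₂ (inj₁ ≡.refl)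
punchIn-adjacent⁻¹ {suc (suc n)} here (suc (suc j)) =
  inj₂ (inj₂ (zero , suc zero , here , ≡.refl , ≡.refl))
punchIn-adjacent⁻¹ (there {k = k} {l} adj) zero =
  inj₂ (inj₂ (k , l , adj , ≡.refl , ≡.refl))
punchIn-adjacent⁻¹ {suc n} (there adj) (suc j) with punchIn-adjacent⁻¹ adj j
... | inj₁ j≡k        = inj₁ (≡.cong suc j≡k)
... | inj₂ (inj₁ j≡l) = inj₂ (inj₁ (≡.cong suc j≡l))
... | inj₂ (inj₂ (k′ , l′ , adj′ , k′↦k , l′↦l)) =
  inj₂ (inj₂ (suc k′ , suc l′ , there adj′ , ≡.cong suc k′↦k , ≡.cong suc l′↦l))

-- The column lists left after deleting k and after deleting l differ in one place, where the other
-- member of the pair survives. Equal columns at k and l thus give equal minors.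
punchIn-adjacent : ∀ {n} {k l : Fin (suc n)} → Adjacent k l → ∀ s →
  punchIn k s ≡ punchIn l s ⊎ punchIn k s ≡ l × punchIn l s ≡ k
punchIn-adjacent here        zero    = inj₂ (≡.refl , ≡.refl)
punchIn-adjacent here        (suc s) = inj₁ ≡.refl
punchIn-adjacent (there adj) zero    = inj₁ ≡.refl
punchIn-adjacent (there adj) (suc s) with punchIn-adjacent adj s
... | inj₁ eq        = inj₁ (≡.cong suc eq)
... | inj₂ (eq , eq′) = inj₂ (≡.cong suc eq , ≡.cong suc eq′)

-- The order presented as a chain of adjacent steps, the transpositions by which two distant columns
-- are brought together.
data _≺_ {n} (k l : Fin n) : Set where
  one  : Adjacent k l → k ≺ l
  more : ∀ {m} → Adjacent k m → m ≺ l → k ≺ l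

suc-≺ : ∀ {n} {k l : Fin n} → k ≺ l → suc k ≺ suc l
suc-≺ (one adj)      = one (there adj)
suc-≺ (more adj m≺l) = more (there adj) (suc-≺ m≺l)

zero≺suc : ∀ {n} (l : Fin n) → zero ≺ suc l
zero≺suc zero    = one here
zero≺suc (suc l) = more here (suc-≺ (zero≺suc l))

≺-connex : ∀ {n} {k l : Fin n} → k ≢ l → k ≺ l ⊎ l ≺ k
≺-connex {k = zero}  {zero}  k≢l = contradiction ≡.refl k≢l
≺-connex {k = zero}  {suc l} k≢l = inj₁ (zero≺suc l)
≺-connex {k = suc k} {zero}  k≢l = inj₂ (zero≺suc k)
≺-connex {k = suc k} {suc l} k≢l with ≺-connex (k≢l ∘ ≡.cong suc)
... | inj₁ k≺l = inj₁ (suc-≺ k≺l)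
... | inj₂ l≺k = inj₂ (suc-≺ l≺k)

≺⇒< : ∀ {n} {k l : Fin n} → k ≺ l → k Fin.< l
≺⇒< (one adj)      = ℕ.≤-reflexive (≡.sym (toℕ-adjacent adj))
≺⇒< (more adj m≺l) = ℕ.<-trans (≺⇒< (one adj)) (≺⇒< m≺l)

-- Determinants, Cramer's rule and coercivity.

module Determinants {c ℓ₁ ℓ₂ ℓ₃ : Level} (ℝ : RealField c ℓ₁ ℓ₂ ℓ₃) where
  open RealField ℝ hiding (zero)
  open Spectra ℝ
  open LinearAlgebra ℝ public
  open Solver
  open SetoidReasoning setoid

  private variable
    n : ℕ

  sum-single : ∀ j {f : Vector Carrier n} → (∀ i → i ≢ j → f i ≈ 0#) → sum f ≈ f j
  sum-single zero    f≈0 = trans (+-congˡ (sum-zero λ i → f≈0 (suc i) λ ())) (+-identityʳ _)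
  sum-single (suc j) f≈0 = trans (+-cong (f≈0 zero λ ()) (sum-single j λ i i≢j →
    f≈0 (suc i) λ { ≡.refl → i≢j ≡.refl })) (+-identityˡ _)

  sum-adjacent : ∀ {k l : Fin n} → Adjacent k l → ∀ {f} →
    f k + f l ≈ 0# → (∀ j → j ≢ k → j ≢ l → f j ≈ 0#) → sum f ≈ 0#
  sum-adjacent here {f} fk+fl≈0 f≈0 = begin
    f zero + (f (suc zero) + sum (λ j → f (suc (suc j))))
      ≈⟨ +-assoc _ _ _ ⟨
    f zero + f (suc zero) + sum (λ j → f (suc (suc j)))
      ≈⟨ +-cong fk+fl≈0 (sum-zero λ j → f≈0 (suc (suc j)) (λ ()) (λ ())) ⟩
    0# + 0#
      ≈⟨ +-identityˡ 0# ⟩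
    0# ∎
  sum-adjacent (there adj) {f} fk+fl≈0 f≈0 = trans
    (+-cong (f≈0 zero (λ ()) (λ ()))
      (sum-adjacent adj fk+fl≈0 λ j j≢k j≢l →
        f≈0 (suc j) (λ { ≡.refl → j≢k ≡.refl }) (λ { ≡.refl → j≢l ≡.refl })))
    (+-identityˡ 0#)

  sign : Fin n → Carrier
  sign j = (- 1#) ^ toℕ j

  minor : Matrix (suc n) → Fin (suc n) → Matrix n
  minor A j r s = A (suc r) (punchIn j s)

  det-cong : ∀ {A B : Matrix n} → (∀ i j → A i j ≈ B i j) → det A ≈ det B
  det-cong {zero}          A≈B = refl
  det-cong {suc n} {A} {B} A≈B = sum-cong-≋ λ j →
    *-cong (*-congˡ {sign j} (A≈B zero j)) (det-cong λ r s → A≈B (suc r) (punchIn j s))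

  AgreeOff : Fin n → Matrix n → Matrix n → Set ℓ₁
  AgreeOff k A B = ∀ i {j} → j ≢ k → A i j ≈ B i j

  -- The expansion runs along a row, so linearity in a column is split by term: where the deleted
  -- column is k, the row entry is linear; elsewhere k survives in the minor, which is linear by
  -- induction. Three matrices that agree off k, instead of column updates, pass to minors
  -- unchanged.
  det-linear : ∀ k a b {A B C : Matrix n} → (∀ i → C i k ≈ a * A i k + b * B i k) →
    AgreeOff k C A → AgreeOff k C B → det C ≈ a * det A + b * det B
  det-linear {suc n} k a b {A} {B} {C} C≈aA+bB C≈A C≈B = trans (sum-cong-≋ term)
    (sum-combination a b (λ j → sign j * A zero j * det (minor A j))
                         (λ j → sign j * B zero j * det (minor B j)))
    where
    term : ∀ j → sign j * C zero j * det (minor C j) ≈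
      a * (sign j * A zero j * det (minor A j)) + b * (sign j * B zero j * det (minor B j))
    term j with j ≟ k
    ... | yes ≡.refl = begin
      sign j * C zero j * det (minor C j)
        ≈⟨ *-congʳ (*-congˡ (C≈aA+bB zero)) ⟩
      sign j * (a * A zero j + b * B zero j) * det (minor C j)
        ≈⟨ solve 6 (λ s a b x y d → s :* (a :* x :+ b :* y) :* d := a :* (s :* x :* d) :+ b :* (s :* y :* d))
             refl (sign j) a b (A zero j) (B zero j) (det (minor C j)) ⟩
      a * (sign j * A zero j * det (minor C j)) + b * (sign j * B zero j * det (minor C j))
        ≈⟨ +-cong (*-congˡ (*-congˡ (det-cong λ r s → C≈A (suc r) (punchInᵢ≢i j s))))
                  (*-congˡ (*-congˡ (det-cong λ r s → C≈B (suc r) (punchInᵢ≢i j s)))) ⟩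
      a * (sign j * A zero j * det (minor A j)) + b * (sign j * B zero j * det (minor B j)) ∎
    ... | no j≢k = begin
      sign j * C zero j * det (minor C j)
        ≈⟨ *-congˡ (det-linear k′ a b
             (λ r → ≡.subst (λ l → C (suc r) l ≈ a * A (suc r) l + b * B (suc r) l)
                      (≡.sym k′↦k) (C≈aA+bB (suc r)))
             (λ r s≢k′ → C≈A (suc r) (off s≢k′)) (λ r s≢k′ → C≈B (suc r) (off s≢k′))) ⟩
      sign j * C zero j * (a * det (minor A j) + b * det (minor B j))
        ≈⟨ solve 6 (λ s a b x d e → s :* x :* (a :* d :+ b :* e) := a :* (s :* x :* d) :+ b :* (s :* x :* e))
             refl (sign j) a b (C zero j) (det (minor A j)) (det (minor B j)) ⟩
      a * (sign j * C zero j * det (minor A j)) + b * (sign j * C zero j * det (minor B j))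
        ≈⟨ +-cong (*-congˡ (*-congʳ (*-congˡ (C≈A zero j≢k)))) (*-congˡ (*-congʳ (*-congˡ (C≈B zero j≢k)))) ⟩
      a * (sign j * A zero j * det (minor A j)) + b * (sign j * B zero j * det (minor B j)) ∎
      where
      k′ : Fin n
      k′ = punchOut j≢k
      k′↦k : punchIn j k′ ≡ k
      k′↦k = punchIn-punchOut j≢k
      off : ∀ {s} → s ≢ k′ → punchIn j s ≢ k
      off s≢k′ eq = s≢k′ (punchIn-injective j _ _ (≡.trans eq (≡.sym k′↦k)))

  sign-adjacent : ∀ {k l : Fin n} → Adjacent k l → sign l ≈ - sign k
  sign-adjacent {k = k} {l} adj = begin
    (- 1#) ^ toℕ l           ≡⟨ ≡.cong ((- 1#) ^_) (toℕ-adjacent adj) ⟩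
    - 1# * (- 1#) ^ toℕ k    ≈⟨ solve 1 (λ s → :- con (ℤ.+ 1) :* s := :- s) refl (sign k) ⟩
    - (- 1#) ^ toℕ k         ∎

  -- The terms deleting k and l have equal minors and opposite signs; every other minor still
  -- contains two equal adjacent columns and vanishes by induction.
  det-adjacent : ∀ {k l : Fin n} → Adjacent k l → ∀ {A : Matrix n} →
    (∀ i → A i k ≈ A i l) → det A ≈ 0#
  det-adjacent {suc n} {k} {l} adj {A} Aₖ≈Aₗ =
    sum-adjacent adj {λ j → sign j * A zero j * det (minor A j)} cancel vanish
    where
    minors : det (minor A k) ≈ det (minor A l)
    minors = det-cong λ r s → entry r s (punchIn-adjacent adj s)
      where
      entry : ∀ r s → punchIn k s ≡ punchIn l s ⊎ punchIn k s ≡ l × punchIn l s ≡ k →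
              A (suc r) (punchIn k s) ≈ A (suc r) (punchIn l s)
      entry r s (inj₁ eq)        = reflexive (≡.cong (A (suc r)) eq)
      entry r s (inj₂ (eq , eq′)) = begin
        A (suc r) (punchIn k s)    ≡⟨ ≡.cong (A (suc r)) eq ⟩
        A (suc r) l                ≈⟨ Aₖ≈Aₗ (suc r) ⟨
        A (suc r) k                ≡⟨ ≡.cong (A (suc r)) eq′ ⟨
        A (suc r) (punchIn l s)    ∎
    cancel : sign k * A zero k * det (minor A k) + sign l * A zero l * det (minor A l) ≈ 0#
    cancel = begin
      sign k * A zero k * det (minor A k) + sign l * A zero l * det (minor A l)
        ≈⟨ +-cong (*-cong (*-congˡ (Aₖ≈Aₗ zero)) minors) (*-congʳ (*-congʳ (sign-adjacent adj))) ⟩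
      sign k * A zero l * det (minor A l) + - sign k * A zero l * det (minor A l)
        ≈⟨ solve 3 (λ s a d → s :* a :* d :+ :- s :* a :* d := con (ℤ.+ 0)) refl (sign k) (A zero l) (det (minor A l)) ⟩
      0# ∎
    vanish : ∀ j → j ≢ k → j ≢ l → sign j * A zero j * det (minor A j) ≈ 0#
    vanish j j≢k j≢l with punchIn-adjacent⁻¹ adj j
    ... | inj₁ j≡k        = contradiction j≡k j≢k
    ... | inj₂ (inj₁ j≡l) = contradiction j≡l j≢l
    ... | inj₂ (inj₂ (k′ , l′ , adj′ , ≡.refl , ≡.refl)) =
      trans (*-congˡ (det-adjacent adj′ λ r → Aₖ≈Aₗ (suc r))) (zeroʳ _)

  infixl 6 _[_]≔_

  _[_]≔_ : Matrix n → Fin n → Vector Carrier n → Matrix n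
  (A [ k ]≔ u) i = updateAt (A i) k λ _ → u i

  ≔-at : ∀ (A : Matrix n) k u i → (A [ k ]≔ u) i k ≈ u i
  ≔-at A k u i = reflexive (updateAt-updates k (A i))

  ≔-off : ∀ (A : Matrix n) k u → AgreeOff k (A [ k ]≔ u) A
  ≔-off A k u i {j} j≢k = reflexive (updateAt-minimal j k (A i) j≢k)

  ≔-cong-off : ∀ (A : Matrix n) k u v → AgreeOff k (A [ k ]≔ u) (A [ k ]≔ v)
  ≔-cong-off A k u v i j≢k = trans (≔-off A k u i j≢k) (sym (≔-off A k v i j≢k))

  det-≔-linear : ∀ (A : Matrix n) k a b u v →
    det (A [ k ]≔ λ i → a * u i + b * v i) ≈ a * det (A [ k ]≔ u) + b * det (A [ k ]≔ v)
  det-≔-linear A k a b u v = det-linear k a b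
    (λ i → trans (≔-at A k (λ i → a * u i + b * v i) i) (sym (+-cong (*-congˡ (≔-at A k u i)) (*-congˡ (≔-at A k v i)))))
    (≔-cong-off A k (λ i → a * u i + b * v i) u) (≔-cong-off A k (λ i → a * u i + b * v i) v)

  ≔-columns : ∀ (A : Matrix n) k u B → (∀ i → B i k ≈ u i) → AgreeOff k B A →
    ∀ i j → (A [ k ]≔ u) i j ≈ B i j
  ≔-columns A k u B Bₖ≈u B≈A i j with j ≟ k
  ... | yes ≡.refl = trans (≔-at A k u i) (sym (Bₖ≈u i))
  ... | no  j≢k    = trans (≔-off A k u i j≢k) (sym (B≈A i j≢k))

  -- Expand the vanishing determinant whose columns k and l are both Aₖ + Aₗ.
  det-swap : ∀ {k l : Fin n} → Adjacent k l → ∀ {A B : Matrix n} →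
    (∀ i → B i k ≈ A i l) → (∀ i → B i l ≈ A i k) →
    (∀ i {j} → j ≢ k → j ≢ l → B i j ≈ A i j) → det B ≈ - det A
  det-swap {n} {k} {l} adj {A} {B} Bₖ≈Aₗ Bₗ≈Aₖ B≈A = begin
    det B                                ≈⟨ solve 2 (λ a b → b := a :+ b :- a) refl (det A) (det B) ⟩
    det A + det B - det A                ≈⟨ +-congʳ (+-cong F-Aₖ-Aₗ F-Aₗ-Aₖ) ⟨
    F Aₖ Aₗ + F Aₗ Aₖ - det A            ≈⟨ +-congʳ (+-cong (+-identityˡ _) (+-identityʳ _)) ⟨
    0# + F Aₖ Aₗ + (F Aₗ Aₖ + 0#) - det A
      ≈⟨ +-congʳ (+-cong (+-congʳ (F-diagonal Aₖ)) (+-congˡ (F-diagonal Aₗ))) ⟨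
    F Aₖ Aₖ + F Aₖ Aₗ + (F Aₗ Aₖ + F Aₗ Aₗ) - det A
      ≈⟨ +-congʳ (+-cong (F-+ʳ Aₖ) (F-+ʳ Aₗ)) ⟨
    F Aₖ Aₖₗ + F Aₗ Aₖₗ - det A          ≈⟨ +-congʳ F-+ˡ ⟨
    F Aₖₗ Aₖₗ - det A                    ≈⟨ +-congʳ (F-diagonal Aₖₗ) ⟩
    0# - det A                           ≈⟨ +-identityˡ _ ⟩
    - det A                              ∎
    where
    Aₖ Aₗ Aₖₗ : Vector Carrier n
    Aₖ i = A i k
    Aₗ i = A i l
    Aₖₗ i = 1# * Aₖ i + 1# * Aₗ i
    k≢l : k ≢ l
    k≢l = <⇒≢ (≺⇒< (one adj))
    F : Vector Carrier n → Vector Carrier n → Carrier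
    F u v = det (A [ k ]≔ u [ l ]≔ v)
    F-diagonal : ∀ u → F u u ≈ 0#
    F-diagonal u = det-adjacent adj λ i →
      trans (≔-off (A [ k ]≔ u) l u i k≢l) (trans (≔-at A k u i) (sym (≔-at (A [ k ]≔ u) l u i)))
    1a+1b : ∀ a b → 1# * a + 1# * b ≈ a + b
    1a+1b a b = +-cong (*-identityˡ a) (*-identityˡ b)
    F-+ʳ : ∀ u → F u Aₖₗ ≈ F u Aₖ + F u Aₗ
    F-+ʳ u = trans (det-≔-linear (A [ k ]≔ u) l 1# 1# Aₖ Aₗ) (1a+1b _ _)
    F-+ˡ : F Aₖₗ Aₖₗ ≈ F Aₖ Aₖₗ + F Aₗ Aₖₗ
    F-+ˡ = trans (det-linear k 1# 1#
      (λ i → trans (at Aₖₗ i) (sym (+-cong (*-congˡ (at Aₖ i)) (*-congˡ (at Aₗ i)))))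
      (off Aₖ) (off Aₗ)) (1a+1b _ _)
      where
      at : ∀ u i → (A [ k ]≔ u [ l ]≔ Aₖₗ) i k ≈ u i
      at u i = trans (≔-off (A [ k ]≔ u) l Aₖₗ i k≢l) (≔-at A k u i)
      off : ∀ u → AgreeOff k (A [ k ]≔ Aₖₗ [ l ]≔ Aₖₗ) (A [ k ]≔ u [ l ]≔ Aₖₗ)
      off u i {j} j≢k with j ≟ l
      ... | yes ≡.refl = trans (≔-at (A [ k ]≔ Aₖₗ) l Aₖₗ i) (sym (≔-at (A [ k ]≔ u) l Aₖₗ i))
      ... | no  j≢l    = trans (≔-off (A [ k ]≔ Aₖₗ) l Aₖₗ i j≢l) (trans (≔-cong-off A k Aₖₗ u i j≢k)
                           (sym (≔-off (A [ k ]≔ u) l Aₖₗ i j≢l)))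
    F-Aₖ-Aₗ : F Aₖ Aₗ ≈ det A
    F-Aₖ-Aₗ = det-cong (≔-columns (A [ k ]≔ Aₖ) l Aₗ A (λ _ → refl) λ i {j} _ →
      sym (≔-columns A k Aₖ A (λ _ → refl) (λ _ _ → refl) i j))
    F-Aₗ-Aₖ : F Aₗ Aₖ ≈ det B
    F-Aₗ-Aₖ = det-cong (≔-columns (A [ k ]≔ Aₗ) l Aₖ B Bₗ≈Aₖ off)
      where
      off : AgreeOff l B (A [ k ]≔ Aₗ)
      off i {j} j≢l with j ≟ k
      ... | yes ≡.refl = trans (Bₖ≈Aₗ i) (sym (≔-at A k Aₗ i))
      ... | no  j≢k    = trans (B≈A i j≢k j≢l) (sym (≔-off A k Aₗ i j≢k))

  -- Swapping k with its neighbour m flips the sign and moves the repeated column one step closer to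
  -- l.
  det-≺ : ∀ {k l : Fin n} → k ≺ l → ∀ {A : Matrix n} → (∀ i → A i k ≈ A i l) → det A ≈ 0#
  det-≺ (one adj) Aₖ≈Aₗ = det-adjacent adj Aₖ≈Aₗ
  det-≺ {n} {k} {l} (more {m} adj m≺l) {A} Aₖ≈Aₗ = begin
    det A        ≈⟨ solve 1 (λ d → d := :- :- d) refl (det A) ⟩
    - - det A    ≈⟨ -‿cong (det-swap adj Bₖ Bₘ B-off) ⟨
    - det B      ≈⟨ -‿cong (det-≺ m≺l λ i → trans (Bₘ i) (trans (Aₖ≈Aₗ i) (sym (B-off i l≢k l≢m)))) ⟩
    - 0#         ≈⟨ solve 0 (:- con (ℤ.+ 0) := con (ℤ.+ 0)) refl ⟩
    0#           ∎
    where
    k≢m : k ≢ m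
    k≢m = <⇒≢ (≺⇒< (one adj))
    l≢m : l ≢ m
    l≢m = <⇒≢ (≺⇒< m≺l) ∘ ≡.sym
    l≢k : l ≢ k
    l≢k = <⇒≢ (≺⇒< (more adj m≺l)) ∘ ≡.sym
    Aₖ Aₘ : Vector Carrier n
    Aₖ i = A i k
    Aₘ i = A i m
    B : Matrix n
    B = A [ k ]≔ Aₘ [ m ]≔ Aₖ
    Bₖ : ∀ i → B i k ≈ A i m
    Bₖ i = trans (≔-off (A [ k ]≔ Aₘ) m Aₖ i k≢m) (≔-at A k Aₘ i)
    Bₘ : ∀ i → B i m ≈ A i k
    Bₘ = ≔-at (A [ k ]≔ Aₘ) m Aₖ
    B-off : ∀ i {j} → j ≢ k → j ≢ m → B i j ≈ A i j
    B-off i j≢k j≢m = trans (≔-off (A [ k ]≔ Aₘ) m Aₖ i j≢m) (≔-off A k Aₘ i j≢k)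

  det-alternating : ∀ {k l : Fin n} → k ≢ l → ∀ {A : Matrix n} → (∀ i → A i k ≈ A i l) → det A ≈ 0#
  det-alternating k≢l Aₖ≈Aₗ with ≺-connex k≢l
  ... | inj₁ k≺l = det-≺ k≺l Aₖ≈Aₗ
  ... | inj₂ l≺k = det-≺ l≺k (sym ∘ Aₖ≈Aₗ)

  det-≔-cong : ∀ (A : Matrix n) k {u v} → (∀ i → u i ≈ v i) → det (A [ k ]≔ u) ≈ det (A [ k ]≔ v)
  det-≔-cong A k {u} {v} u≈v = det-cong (≔-columns A k u (A [ k ]≔ v)
    (λ i → trans (≔-at A k v i) (sym (u≈v i))) (≔-off A k v))

  -- The width m of V is kept independent of n so that induction can peel off one summand at a time.
  det-≔-sum : ∀ (A : Matrix n) j {m} (V : Fin n → Vector Carrier m) x →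
    det (A [ j ]≔ λ i → V i ∙ x) ≈ sum λ k → x k * det (A [ j ]≔ λ i → V i k)
  det-≔-sum A j {zero} V x = begin
    -- A zero column is the combination of itself with itself with both coefficients 0.
    det (A [ j ]≔ λ _ → 0#)    ≈⟨ det-linear j 0# 0# zero-column (λ _ _ → refl) (λ _ _ → refl) ⟩
    0# * d + 0# * d            ≈⟨ solve 1 (λ d → con (ℤ.+ 0) :* d :+ con (ℤ.+ 0) :* d := con (ℤ.+ 0)) refl d ⟩
    0#                         ∎
    where
    d = det (A [ j ]≔ λ _ → 0#)
    zero-column : ∀ i → (A [ j ]≔ λ _ → 0#) i j ≈ 0# * (A [ j ]≔ λ _ → 0#) i j + 0# * (A [ j ]≔ λ _ → 0#) i j
    zero-column i = trans (≔-at A j (λ _ → 0#) i)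
      (solve 1 (λ d → con (ℤ.+ 0) := con (ℤ.+ 0) :* d :+ con (ℤ.+ 0) :* d) refl _)
  det-≔-sum A j {suc m} V x = begin
    det (A [ j ]≔ λ i → V i zero * x zero + rest i)
      ≈⟨ det-≔-cong A j (λ i → +-cong (*-comm _ _) (sym (*-identityˡ _))) ⟩
    det (A [ j ]≔ λ i → x zero * V i zero + 1# * rest i)
      ≈⟨ det-≔-linear A j (x zero) 1# (λ i → V i zero) rest ⟩
    x zero * det (A [ j ]≔ λ i → V i zero) + 1# * det (A [ j ]≔ rest)
      ≈⟨ +-congˡ (trans (*-identityˡ _) (det-≔-sum A j (λ i k → V i (suc k)) (x ∘ suc))) ⟩
    sum (λ k → x k * det (A [ j ]≔ λ i → V i k)) ∎
    where
    rest : Vector Carrier _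
    rest i = (λ k → V i (suc k)) ∙ (x ∘ suc)

  -- The column A x is the combination of the columns of A with coefficients x k; every summand with
  -- k other than j repeats a column and vanishes.
  cramer : ∀ (A : Matrix n) x j → x j * det A ≈ det (A [ j ]≔ A ⊛ x)
  cramer {n} A x j = sym (begin
    det (A [ j ]≔ A ⊛ x)                              ≈⟨ det-≔-sum A j A x ⟩
    sum (λ k → x k * det (A [ j ]≔ λ i → A i k))
      ≈⟨ sum-single j {λ k → x k * det (A [ j ]≔ λ i → A i k)} repeated ⟩
    x j * det (A [ j ]≔ λ i → A i j)
      ≈⟨ *-congˡ (det-cong (≔-columns A j _ A (λ _ → refl) (λ _ _ → refl))) ⟩
    x j * det A                                       ∎)
    where
    repeated : ∀ k → k ≢ j → x k * det (A [ j ]≔ λ i → A i k) ≈ 0#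
    repeated k k≢j = trans (*-congˡ (det-alternating (k≢j ∘ ≡.sym) λ i →
      trans (≔-at A j (λ i → A i k) i) (sym (≔-off A j (λ i → A i k) i k≢j)))) (zeroʳ _)

  diag-at : ∀ (a : Vector Carrier n) i → diag a i i ≈ a i
  diag-at a i with i ≟ i
  ... | yes _  = refl
  ... | no i≢i = contradiction ≡.refl i≢i

  diag-off : ∀ (a : Vector Carrier n) {i j} → i ≢ j → diag a i j ≈ 0#
  diag-off a {i} {j} i≢j with i ≟ j
  ... | yes i≡j = contradiction i≡j i≢j
  ... | no  _   = refl

  diag-⊛ : ∀ (a x : Vector Carrier n) i → (diag a ⊛ x) i ≈ a i * x i
  diag-⊛ a x i = trans (sum-single i {λ j → diag a i j * x j} λ j j≢i →
    trans (*-congʳ (diag-off a (j≢i ∘ ≡.sym))) (zeroˡ _)) (*-congʳ (diag-at a i))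

  -- Serves twice: nonnegativity of the left side is Cauchy-Schwarz against the all-ones vector, and
  -- on zero-sum vectors it evaluates the Laplacian form of the complete graph.
  sum-square-differences : ∀ (x : Vector Carrier n) →
    sum (λ i → sum λ j → (x i - x j) * (x i - x j)) ≈
    fromNat n * ∥ x ∥² + fromNat n * ∥ x ∥² - (sum x * sum x + sum x * sum x)
  sum-square-differences {n} x = begin
    sum (λ i → sum λ j → (x i - x j) * (x i - x j))
      ≈⟨ sum-cong-≋ (λ i → row (x i)) ⟩
    sum (λ i → 1# * (N * (x i * x i) + - (S + S) * x i) + ∥ x ∥² * 1#)
      ≈⟨ sum-combination 1# ∥ x ∥² (λ i → N * (x i * x i) + - (S + S) * x i) (λ _ → 1#) ⟩
    1# * sum (λ i → N * (x i * x i) + - (S + S) * x i) + ∥ x ∥² * sum {n} (λ _ → 1#)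
      ≈⟨ +-cong (*-congˡ (sum-combination N (- (S + S)) (λ i → x i * x i) x)) (*-congˡ (sum-const n 1#)) ⟩
    1# * (N * ∥ x ∥² + - (S + S) * S) + ∥ x ∥² * (N * 1#)
      ≈⟨ solve 3 (λ N q S → con (ℤ.+ 1) :* (N :* q :+ :- (S :+ S) :* S) :+ q :* (N :* con (ℤ.+ 1))
                          := N :* q :+ N :* q :- (S :* S :+ S :* S)) refl N ∥ x ∥² S ⟩
    N * ∥ x ∥² + N * ∥ x ∥² - (S * S + S * S) ∎
    where
    N = fromNat n
    S = sum x
    row : ∀ a → sum (λ j → (a - x j) * (a - x j)) ≈ 1# * (N * (a * a) + - (S + S) * a) + ∥ x ∥² * 1#
    row a = begin
      sum (λ j → (a - x j) * (a - x j))
        ≈⟨ sum-cong-≋ (λ j → solve 2 (λ a y → (a :- y) :* (a :- y)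
             := con (ℤ.+ 1) :* (con (ℤ.+ 1) :* (a :* a) :+ :- (a :+ a) :* y) :+ con (ℤ.+ 1) :* (y :* y)) refl a (x j)) ⟩
      sum (λ j → 1# * (1# * (a * a) + - (a + a) * x j) + 1# * (x j * x j))
        ≈⟨ sum-combination 1# 1# (λ j → 1# * (a * a) + - (a + a) * x j) (λ j → x j * x j) ⟩
      1# * sum (λ j → 1# * (a * a) + - (a + a) * x j) + 1# * ∥ x ∥²
        ≈⟨ +-congʳ (*-congˡ (sum-combination 1# (- (a + a)) (λ _ → a * a) x)) ⟩
      1# * (1# * sum {n} (λ _ → a * a) + - (a + a) * S) + 1# * ∥ x ∥²
        ≈⟨ +-congʳ (*-congˡ (+-congʳ (*-congˡ (sum-const n (a * a))))) ⟩
      1# * (1# * (N * (a * a)) + - (a + a) * S) + 1# * ∥ x ∥²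
        ≈⟨ solve 4 (λ N a S q → con (ℤ.+ 1) :* (con (ℤ.+ 1) :* (N :* (a :* a)) :+ :- (a :+ a) :* S) :+ con (ℤ.+ 1) :* q
                              := con (ℤ.+ 1) :* (N :* (a :* a) :+ :- (S :+ S) :* a) :+ q :* con (ℤ.+ 1)) refl N a S ∥ x ∥² ⟩
      1# * (N * (a * a) + - (S + S) * a) + ∥ x ∥² * 1# ∎

  halve-nonNeg : ∀ {x} → 0# ≤ x + x → 0# ≤ x
  halve-nonNeg {x} 0≤x+x = *-cancelˡ-nonNeg (+-pos-nonNeg 0<1 0≤1)
    (≤-trans 0≤x+x (≤-reflexive (solve 1 (λ x → x :+ x := (con (ℤ.+ 1) :+ con (ℤ.+ 1)) :* x) refl x)))

  sum-square-≤ : ∀ (x : Vector Carrier n) → sum x * sum x ≤ fromNat n * ∥ x ∥²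
  sum-square-≤ {n} x = 0≤y-x⇒x≤y (halve-nonNeg (≤-trans
    (sum-nonNeg λ i → sum-nonNeg λ j → square-nonNeg (x i - x j))
    (≤-reflexive (trans (sum-square-differences x)
      (solve 2 (λ a b → a :+ a :- (b :+ b) := a :- b :+ (a :- b)) refl (fromNat n * ∥ x ∥²) (sum x * sum x))))))

  -- This is (n!)² Cⁿ, a crude Hadamard bound: each level of the expansion costs one factor n from
  -- Cauchy-Schwarz and one from the number of terms. What matters is that it depends on the entries
  -- only through C, hence can be uniform in t.
  detBound : ℕ → Carrier → Carrier
  detBound zero    C = 1#
  detBound (suc n) C = fromNat (suc n) * (fromNat (suc n) * (C * detBound n C))

  detBound-nonNeg : ∀ n {C} → 0# ≤ C → 0# ≤ detBound n C
  detBound-nonNeg zero    0≤C = 0≤1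
  detBound-nonNeg (suc n) 0≤C = *-nonNeg (fromNat-nonNeg (suc n))
    (*-nonNeg (fromNat-nonNeg (suc n)) (*-nonNeg 0≤C (detBound-nonNeg n 0≤C)))

  sign-square : ∀ (j : Fin n) → sign j * sign j ≈ 1#
  sign-square zero    = *-identityˡ 1#
  sign-square (suc j) = trans
    (solve 1 (λ s → (:- con (ℤ.+ 1) :* s) :* (:- con (ℤ.+ 1) :* s) := s :* s) refl (sign j)) (sign-square j)

  det-square-≤ : ∀ {A : Matrix n} {C} → 0# ≤ C → (∀ i j → A i j * A i j ≤ C) →
    det A * det A ≤ detBound n C
  det-square-≤ {zero}          0≤C A²≤C = ≤-reflexive (*-identityˡ 1#)
  det-square-≤ {suc n} {A} {C} 0≤C A²≤C = ≤-trans (sum-square-≤ term)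
    (*-monoˡ-≤ (fromNat-nonNeg (suc n)) (≤-trans (sum-mono-≤ term-square-≤)
      (≤-reflexive (sum-const (suc n) (C * detBound n C)))))
    where
    term : Vector Carrier (suc n)
    term j = sign j * A zero j * det (minor A j)
    term-square-≤ : ∀ j → term j * term j ≤ C * detBound n C
    term-square-≤ j = ≤-trans
      (≤-reflexive (trans
        (solve 3 (λ s a d → s :* a :* d :* (s :* a :* d) := s :* s :* (a :* a :* (d :* d)))
           refl (sign j) (A zero j) (det (minor A j)))
        (trans (*-congʳ (sign-square j)) (*-identityˡ _))))
      (*-mono-≤ (square-nonNeg (A zero j)) (detBound-nonNeg n 0≤C) (A²≤C zero j)
        (det-square-≤ 0≤C λ r s → A²≤C (suc r) (punchIn j s)))

  -- Cramer's rule writes det A times x as the adjugate applied to A x, and the entries of the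
  -- adjugate are bounded by `det-square-≤`. The condition 1 ≤ C covers the unit columns that occur
  -- in them.
  coercivity : ∀ {A : Matrix n} {C} → 1# ≤ C → (∀ i j → A i j * A i j ≤ C) → ∀ x →
    det A * det A * ∥ x ∥² ≤ fromNat n * (fromNat n * detBound n C) * ∥ A ⊛ x ∥²
  coercivity {n} {A} {C} 1≤C A²≤C x = ≤-trans
    (≤-reflexive (*-distribˡ-sum (det A * det A) (λ j → x j * x j)))
    (≤-trans (sum-mono-≤ component-≤)
      (≤-reflexive (trans (sum-const n (fromNat n * (K * ∥ y ∥²)))
        (solve 3 (λ N K q → N :* (N :* (K :* q)) := N :* (N :* K) :* q) refl (fromNat n) K ∥ y ∥²))))
    where
    K = detBound n C
    y = A ⊛ x
    0≤C : 0# ≤ C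
    0≤C = ≤-trans 0≤1 1≤C
    I : Matrix n
    I = diag λ _ → 1#
    I-square-≤ : ∀ i j → I i j * I i j ≤ C
    I-square-≤ i j with i ≟ j
    ... | yes _ = ≤-trans (≤-reflexive (*-identityˡ 1#)) 1≤C
    ... | no  _ = ≤-trans (≤-reflexive (zeroˡ 0#)) 0≤C
    -- The adjugate of A: its entry at j, k replaces column j by the k-th unit vector.
    D : Matrix n
    D j k = det (A [ j ]≔ λ i → I i k)
    D-square-≤ : ∀ j k → D j k * D j k ≤ K
    D-square-≤ j k = det-square-≤ 0≤C entry
      where
      Iₖ : Vector Carrier n
      Iₖ i = I i k
      entry : ∀ r s → (A [ j ]≔ Iₖ) r s * (A [ j ]≔ Iₖ) r s ≤ C
      entry r s with s ≟ j
      ... | yes ≡.refl = ≤-trans (≤-reflexive (*-cong (≔-at A j Iₖ r) (≔-at A j Iₖ r))) (I-square-≤ r k)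
      ... | no  s≢j    = ≤-trans (≤-reflexive (*-cong (≔-off A j Iₖ r s≢j) (≔-off A j Iₖ r s≢j))) (A²≤C r s)
    component : ∀ j → x j * det A ≈ sum λ k → y k * D j k
    component j = begin
      x j * det A                     ≈⟨ cramer A x j ⟩
      det (A [ j ]≔ y)
        ≈⟨ det-≔-cong A j (λ i → trans (diag-⊛ (λ _ → 1#) y i) (*-identityˡ (y i))) ⟨
      det (A [ j ]≔ λ i → I i ∙ y)    ≈⟨ det-≔-sum A j I y ⟩
      sum (λ k → y k * D j k)         ∎
    component-≤ : ∀ j → det A * det A * (x j * x j) ≤ fromNat n * (K * ∥ y ∥²)
    component-≤ j = ≤-trans
      (≤-reflexive (trans (solve 2 (λ d x → d :* d :* (x :* x) := x :* d :* (x :* d)) refl (det A) (x j))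
        (*-cong (component j) (component j))))
      (≤-trans (sum-square-≤ (λ k → y k * D j k))
        (*-monoˡ-≤ (fromNat-nonNeg n) (≤-trans
          (sum-mono-≤ λ k → ≤-trans
            (≤-reflexive (solve 2 (λ y d → y :* d :* (y :* d) := y :* y :* (d :* d)) refl (y k) (D j k)))
            (≤-trans (*-monoˡ-≤ (square-nonNeg (y k)) (D-square-≤ j k)) (≤-reflexive (*-comm _ K))))
          (≤-reflexive (sym (*-distribˡ-sum K (λ k → y k * y k)))))))

-- Laplacians with weights between 1 and 2, and their eigenvalues.

module WeightedLaplacian {c ℓ₁ ℓ₂ ℓ₃ : Level} (ℝ : RealField c ℓ₁ ℓ₂ ℓ₃) where
  open RealField ℝ hiding (zero)
  open Spectra ℝ
  open Determinants ℝ public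
  open Solver
  open SetoidReasoning setoid

  private variable
    n : ℕ

  product-pos : ∀ {f : Vector Carrier n} → (∀ i → 0# < f i) → 0# < product f
  product-pos {zero}  0<f = 0<1
  product-pos {suc n} 0<f = *-positive (0<f zero) (product-pos (0<f ∘ suc))

  product-square-≤ : ∀ {f g : Vector Carrier n} → (∀ i → 0# < g i) → (∀ i → g i ≤ f i * f i) →
    product g ≤ product f * product f
  product-square-≤ {zero}          0<g g≤f² = ≤-reflexive (sym (*-identityˡ 1#))
  product-square-≤ {suc n} {f} {g} 0<g g≤f² = ≤-trans
    (*-mono-≤ (<⇒≤ (0<g zero)) (square-nonNeg _) (g≤f² zero) (product-square-≤ (0<g ∘ suc) (g≤f² ∘ suc)))
    (≤-reflexive (solve 2 (λ a p → a :* a :* (p :* p) := a :* p :* (a :* p))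
      refl (f zero) (product (f ∘ suc))))

  square-≤ : ∀ {a b} → a ≤ b → - b ≤ a → a * a ≤ b * b
  square-≤ {a} {b} a≤b -b≤a = ≤-by (*-nonNeg (x≤y⇒0≤y-x a≤b) (x≤y⇒0≤y-x -b≤a))
    (solve 2 (λ a b → b :* b :- a :* a := (b :- a) :* (a :- :- b)) refl a b)

  x≤x+y : ∀ {x y} → 0# ≤ y → x ≤ x + y
  x≤x+y {x} {y} 0≤y = ≤-by 0≤y (solve 2 (λ x y → x :+ y :- x := y) refl x y)

  -- An abstraction of the distance matrix in diameter two: symmetric, zero on the diagonal, with
  -- values between 1 and 2 elsewhere, and with the transmissions as row sums.
  module Laplacian {n} (D : Matrix n) (D-sym : SymmetricMatrix D) (D-diag : ∀ i → D i i ≈ 0#)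
                   (1≤D : ∀ {i j} → i ≢ j → 1# ≤ D i j) (D≤2 : ∀ i j → D i j ≤ 1# + 1#)
                   (τ : Vector Carrier n) (τ≈∑D : ∀ i → τ i ≈ sum (D i)) where

    private
      N = fromNat n

    L : Matrix n
    L i j = diag τ i j - D i j

    L-off : ∀ {i j} → i ≢ j → L i j ≈ - D i j
    L-off i≢j = trans (+-congʳ (diag-off τ i≢j)) (+-identityˡ _)

    L-diag : ∀ i → L i i ≈ τ i
    L-diag i = trans (+-cong (diag-at τ i) (-‿cong (D-diag i)))
      (solve 1 (λ t → t :- con (ℤ.+ 0) := t) refl (τ i))

    L-sym : SymmetricMatrix L
    L-sym i j = swap (i ≟ j)
      where
      swap : Dec (i ≡ j) → L i j ≈ L j i
      swap (yes i≡j) = reflexive (≡.cong₂ L i≡j (≡.sym i≡j))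
      swap (no  i≢j) = trans (L-off i≢j) (trans (-‿cong (D-sym i j)) (sym (L-off (i≢j ∘ ≡.sym))))

    ⊛-minus : ∀ (A B : Matrix n) x i → ((λ i j → A i j - B i j) ⊛ x) i ≈ (A ⊛ x) i - (B ⊛ x) i
    ⊛-minus A B x i = begin
      sum (λ j → (A i j - B i j) * x j)
        ≈⟨ sum-cong-≋ (λ j → solve 3 (λ a b x → (a :- b) :* x := con (ℤ.+ 1) :* (a :* x) :+ :- con (ℤ.+ 1) :* (b :* x)) refl (A i j) (B i j) (x j)) ⟩
      sum (λ j → 1# * (A i j * x j) + - 1# * (B i j * x j))
        ≈⟨ sum-combination 1# (- 1#) (λ j → A i j * x j) (λ j → B i j * x j) ⟩
      1# * (A ⊛ x) i + - 1# * (B ⊛ x) i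
        ≈⟨ solve 2 (λ a b → con (ℤ.+ 1) :* a :+ :- con (ℤ.+ 1) :* b := a :- b) refl ((A ⊛ x) i) ((B ⊛ x) i) ⟩
      (A ⊛ x) i - (B ⊛ x) i ∎

    L-⊛ : ∀ x i → (L ⊛ x) i ≈ τ i * x i - (D ⊛ x) i
    L-⊛ x i = trans (⊛-minus (diag τ) D x i) (+-congʳ (diag-⊛ τ x i))

    L-rowSums : ∀ i → sum (L i) ≈ 0#
    L-rowSums i = begin
      sum (L i)                                ≈⟨ sum-cong-≋ (λ j → *-identityʳ (L i j)) ⟨
      (L ⊛ λ _ → 1#) i                         ≈⟨ L-⊛ (λ _ → 1#) i ⟩
      τ i * 1# - (D ⊛ λ _ → 1#) i
        ≈⟨ +-cong (*-identityʳ _) (-‿cong (sum-cong-≋ λ j → *-identityʳ (D i j))) ⟩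
      τ i - sum (D i)                          ≈⟨ +-congˡ (-‿cong (τ≈∑D i)) ⟨
      τ i - τ i                                ≈⟨ -‿inverseʳ _ ⟩
      0#                                       ∎

    differences : Matrix n → Vector Carrier n → Carrier
    differences W x = sum λ i → sum λ j → W i j * ((x i - x j) * (x i - x j))

    -- The form is doubled because the right side runs over ordered pairs; this avoids halving.
    L-form : ∀ x → x ∙ L ⊛ x + x ∙ L ⊛ x ≈ differences D x
    L-form x = sym (begin
      sum (λ i → sum λ j → D i j * ((x i - x j) * (x i - x j)))
        ≈⟨ sum-cong-≋ row ⟩
      sum (λ i → (1# + 1#) * (x i * (L ⊛ x) i) + - 1# * (x i * (x i * τ i) - sum λ j → D i j * (x j * x j)))
        ≈⟨ sum-combination (1# + 1#) (- 1#) (λ i → x i * (L ⊛ x) i) (λ i → x i * (x i * τ i) - sum λ j → D i j * (x j * x j)) ⟩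
      (1# + 1#) * (x ∙ L ⊛ x) + - 1# * sum (λ i → x i * (x i * τ i) - sum λ j → D i j * (x j * x j))
        ≈⟨ +-congˡ (*-congˡ balance) ⟩
      (1# + 1#) * (x ∙ L ⊛ x) + - 1# * 0#
        ≈⟨ solve 1 (λ q → (con (ℤ.+ 1) :+ con (ℤ.+ 1)) :* q :+ :- con (ℤ.+ 1) :* con (ℤ.+ 0) := q :+ q) refl (x ∙ L ⊛ x) ⟩
      x ∙ L ⊛ x + x ∙ L ⊛ x ∎)
      where
      Dx² : Vector Carrier n
      Dx² i = sum λ j → D i j * (x j * x j)
      -- A single row misses twice its share of the form by a defect whose total over all rows
      -- vanishes by symmetry of D, as `balance` shows.
      row : ∀ i → sum (λ j → D i j * ((x i - x j) * (x i - x j))) ≈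
                  (1# + 1#) * (x i * (L ⊛ x) i) + - 1# * (x i * (x i * τ i) - Dx² i)
      row i = begin
        sum (λ j → D i j * ((x i - x j) * (x i - x j)))
          ≈⟨ sum-cong-≋ (λ j → solve 3 (λ d a b → d :* ((a :- b) :* (a :- b))
               := con (ℤ.+ 1) :* ((a :* a) :* d :+ :- (a :+ a) :* (d :* b)) :+ con (ℤ.+ 1) :* (d :* (b :* b))) refl (D i j) (x i) (x j)) ⟩
        sum (λ j → 1# * ((x i * x i) * D i j + - (x i + x i) * (D i j * x j)) + 1# * (D i j * (x j * x j)))
          ≈⟨ sum-combination 1# 1# (λ j → (x i * x i) * D i j + - (x i + x i) * (D i j * x j)) (λ j → D i j * (x j * x j)) ⟩
        1# * sum (λ j → (x i * x i) * D i j + - (x i + x i) * (D i j * x j)) + 1# * Dx² i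
          ≈⟨ +-congʳ (*-congˡ (sum-combination (x i * x i) (- (x i + x i)) (D i) (λ j → D i j * x j))) ⟩
        1# * ((x i * x i) * sum (D i) + - (x i + x i) * (D ⊛ x) i) + 1# * Dx² i
          ≈⟨ +-congʳ (*-congˡ (+-congʳ (*-congˡ (τ≈∑D i)))) ⟨
        1# * ((x i * x i) * τ i + - (x i + x i) * (D ⊛ x) i) + 1# * Dx² i
          ≈⟨ solve 4 (λ a t y s → con (ℤ.+ 1) :* ((a :* a) :* t :+ :- (a :+ a) :* y) :+ con (ℤ.+ 1) :* s
               := (con (ℤ.+ 1) :+ con (ℤ.+ 1)) :* (a :* (t :* a :- y)) :+ :- con (ℤ.+ 1) :* (a :* (a :* t) :- s))
               refl (x i) (τ i) ((D ⊛ x) i) (Dx² i) ⟩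
        (1# + 1#) * (x i * (τ i * x i - (D ⊛ x) i)) + - 1# * (x i * (x i * τ i) - Dx² i)
          ≈⟨ +-congʳ (*-congˡ (*-congˡ (L-⊛ x i))) ⟨
        (1# + 1#) * (x i * (L ⊛ x) i) + - 1# * (x i * (x i * τ i) - Dx² i) ∎
      ∑Dx²≈ : sum Dx² ≈ sum λ i → x i * (x i * τ i)
      ∑Dx²≈ = begin
        sum (λ i → sum λ j → D i j * (x j * x j))    ≈⟨ ∑-comm (λ i j → D i j * (x j * x j)) ⟩
        sum (λ j → sum λ i → D i j * (x j * x j))
          ≈⟨ sum-cong-≋ (λ j → *-distribʳ-sum (x j * x j) λ i → D i j) ⟨
        sum (λ j → sum (λ i → D i j) * (x j * x j))
          ≈⟨ sum-cong-≋ (λ j → trans (*-congʳ (trans (sum-cong-≋ λ i → D-sym i j) (sym (τ≈∑D j))))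
                                                            (solve 2 (λ t a → t :* (a :* a) := a :* (a :* t)) refl (τ j) (x j))) ⟩
        sum (λ j → x j * (x j * τ j))                ∎
      balance : sum (λ i → x i * (x i * τ i) - Dx² i) ≈ 0#
      balance = begin
        sum (λ i → x i * (x i * τ i) - Dx² i)
          ≈⟨ sum-cong-≋ (λ i → solve 2 (λ a b → a :- b := con (ℤ.+ 1) :* a :+ :- con (ℤ.+ 1) :* b) refl (x i * (x i * τ i)) (Dx² i)) ⟩
        sum (λ i → 1# * (x i * (x i * τ i)) + - 1# * Dx² i)
          ≈⟨ sum-combination 1# (- 1#) (λ i → x i * (x i * τ i)) Dx² ⟩
        1# * sum (λ i → x i * (x i * τ i)) + - 1# * sum Dx²
          ≈⟨ +-congˡ (*-congˡ ∑Dx²≈) ⟩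
        1# * sum (λ i → x i * (x i * τ i)) + - 1# * sum (λ i → x i * (x i * τ i))
          ≈⟨ solve 1 (λ a → con (ℤ.+ 1) :* a :+ :- con (ℤ.+ 1) :* a := con (ℤ.+ 0)) refl (sum λ i → x i * (x i * τ i)) ⟩
        0# ∎

    differences-mono-≤ : ∀ {V W : Matrix n} x → (∀ i j → V i j * ((x i - x j) * (x i - x j)) ≤ W i j * ((x i - x j) * (x i - x j))) →
      differences V x ≤ differences W x
    differences-mono-≤ x V≤W = sum-mono-≤ λ i → sum-mono-≤ λ j → V≤W i j

    differences-const : ∀ a x → sum x ≈ 0# → differences (λ _ _ → a) x ≈ a * (N * ∥ x ∥²) + a * (N * ∥ x ∥²)
    differences-const a x ∑x≈0 = begin
      sum (λ i → sum λ j → a * ((x i - x j) * (x i - x j)))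
        ≈⟨ sum-cong-≋ (λ i → *-distribˡ-sum a λ j → (x i - x j) * (x i - x j)) ⟨
      sum (λ i → a * sum λ j → (x i - x j) * (x i - x j))
        ≈⟨ *-distribˡ-sum a (λ i → sum λ j → (x i - x j) * (x i - x j)) ⟨
      a * sum (λ i → sum λ j → (x i - x j) * (x i - x j))
        ≈⟨ *-congˡ (sum-square-differences x) ⟩
      a * (N * ∥ x ∥² + N * ∥ x ∥² - (sum x * sum x + sum x * sum x))
        ≈⟨ *-congˡ (+-congˡ (-‿cong (+-cong (*-congʳ ∑x≈0) (*-congʳ ∑x≈0)))) ⟩
      a * (N * ∥ x ∥² + N * ∥ x ∥² - (0# * sum x + 0# * sum x))
        ≈⟨ solve 4 (λ a N q s → a :* (N :* q :+ N :* q :- (con (ℤ.+ 0) :* s :+ con (ℤ.+ 0) :* s)) := a :* (N :* q) :+ a :* (N :* q))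
             refl a N ∥ x ∥² (sum x) ⟩
      a * (N * ∥ x ∥²) + a * (N * ∥ x ∥²) ∎

    double-≤ : ∀ {a b} → a + a ≤ b + b → a ≤ b
    double-≤ {a} {b} 2a≤2b = 0≤y-x⇒x≤y (halve-nonNeg (≤-trans (x≤y⇒0≤y-x 2a≤2b)
      (≤-reflexive (solve 2 (λ a b → b :+ b :- (a :+ a) := b :- a :+ (b :- a)) refl a b))))

    -- Replacing all weights by 1 turns the form into that of the complete graph, which is n times
    -- the squared norm on zero-sum vectors. For `L-upper` the weights become 2.
    L-lower : ∀ {x} → sum x ≈ 0# → N * ∥ x ∥² ≤ x ∙ L ⊛ x
    L-lower {x} ∑x≈0 = double-≤ (≤-trans
      (≤-reflexive (trans (+-cong (sym (*-identityˡ _)) (sym (*-identityˡ _))) (sym (differences-const 1# x ∑x≈0))))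
      (≤-trans (differences-mono-≤ {W = D} x term) (≤-reflexive (sym (L-form x)))))
      where
      term : ∀ i j → 1# * ((x i - x j) * (x i - x j)) ≤ D i j * ((x i - x j) * (x i - x j))
      term i j with i ≟ j
      -- The diagonal weight 0 is below 1, but the squared difference it multiplies is 0.
      ... | yes ≡.refl = ≤-reflexive (solve 2 (λ d a → con (ℤ.+ 1) :* ((a :- a) :* (a :- a)) := d :* ((a :- a) :* (a :- a))) refl (D i i) (x i))
      ... | no  i≢j    = *-monoʳ-≤ (square-nonNeg _) (1≤D i≢j)

    L-upper : ∀ {x} → sum x ≈ 0# → x ∙ L ⊛ x ≤ (N + N) * ∥ x ∥²
    L-upper {x} ∑x≈0 = double-≤ (≤-trans (≤-reflexive (L-form x)) (≤-trans
      (differences-mono-≤ {D} x λ i j → *-monoʳ-≤ (square-nonNeg _) (D≤2 i j))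
      (≤-reflexive (trans (differences-const (1# + 1#) x ∑x≈0)
        (solve 2 (λ N q → (con (ℤ.+ 1) :+ con (ℤ.+ 1)) :* (N :* q) :+ (con (ℤ.+ 1) :+ con (ℤ.+ 1)) :* (N :* q)
                        := (N :+ N) :* q :+ (N :+ N) :* q) refl N ∥ x ∥²)))))

    -- Written exactly as the matrix inside `charPoly`, so that `factorisation` speaks of its
    -- determinant without conversion.
    pencil : Carrier → Matrix n
    pencil t i j = diag (λ _ → t) i j - L i j

    pencil-⊛ : ∀ t x i → (pencil t ⊛ x) i ≈ t * x i - (L ⊛ x) i
    pencil-⊛ t x i = trans (⊛-minus (diag λ _ → t) L x i) (+-congʳ (diag-⊛ (λ _ → t) x i))

    module Spectrum (1≤n : 1# ≤ N) {∂ : Vector Carrier n} (spectrum : IsSpectrum L ∂) where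
      open IsSpectrum spectrum

      private
        1≤2N : 1# ≤ N + N
        1≤2N = ≤-trans 1≤n (x≤x+y (≤-trans 0≤1 1≤n))

        -- For t between 0 and 2n every entry of t - L is at most 2n in absolute value, because
        -- transmissions are at most 2n.
        C = (N + N) * (N + N)
        κ = N * (N * detBound n C)

        1≤C : 1# ≤ C
        1≤C = ≤-trans (≤-reflexive (sym (*-identityˡ 1#))) (square-mono-≤ 0≤1 1≤2N)

        0≤2N : 0# ≤ N + N
        0≤2N = ≤-trans 0≤1 1≤2N

        0<2N : 0# < N + N
        0<2N = <-≤-trans 0<1 1≤2N

        0≤D : ∀ i j → 0# ≤ D i j
        0≤D i j with i ≟ j
        ... | yes ≡.refl = ≤-reflexive (sym (D-diag i))
        ... | no  i≢j    = ≤-trans 0≤1 (1≤D i≢j)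

        0≤τ : ∀ i → 0# ≤ τ i
        0≤τ i = ≤-trans (sum-nonNeg (0≤D i)) (≤-reflexive (sym (τ≈∑D i)))

        τ≤2N : ∀ i → τ i ≤ N + N
        τ≤2N i = ≤-trans (≤-reflexive (τ≈∑D i)) (≤-trans (sum-mono-≤ (D≤2 i))
          (≤-reflexive (trans (sum-const n (1# + 1#)) (solve 1 (λ N → N :* (con (ℤ.+ 1) :+ con (ℤ.+ 1)) := N :+ N) refl N))))

        -‿nonPos : ∀ {a b} → 0# ≤ a → 0# ≤ b → - a ≤ b
        -‿nonPos {a} {b} 0≤a 0≤b = ≤-by (+-nonNeg 0≤a 0≤b) (solve 2 (λ a b → b :- :- a := a :+ b) refl a b)

      pencil-entries : ∀ {t} → 0# ≤ t → t ≤ N + N → ∀ i j → pencil t i j * pencil t i j ≤ C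
      pencil-entries {t} 0≤t t≤2N i j with i ≟ j
      ... | yes ≡.refl = ≤-trans (≤-reflexive (*-cong entry entry)) (square-≤
        (≤-trans (≤-by (0≤τ i) (solve 2 (λ t τ → t :- (t :- τ) := τ) refl t (τ i))) t≤2N)
        (≤-by (+-nonNeg 0≤t (x≤y⇒0≤y-x (τ≤2N i)))
          (solve 3 (λ t τ N → t :- τ :- :- N := t :+ (N :- τ)) refl t (τ i) (N + N))))
        where
        entry : t - (τ i - D i i) ≈ t - τ i
        entry = +-congˡ (-‿cong (trans (+-congˡ (-‿cong (D-diag i))) (solve 1 (λ t → t :- con (ℤ.+ 0) := t) refl (τ i))))
      ... | no  i≢j = ≤-trans (≤-reflexive (*-cong entry entry)) (square-≤
        (≤-trans (D≤2 i j) (+-mono-≤ 1≤n 1≤n)) (-‿nonPos 0≤2N (0≤D i j)))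
        where
        entry : 0# - (0# - D i j) ≈ D i j
        entry = solve 1 (λ d → con (ℤ.+ 0) :- (con (ℤ.+ 0) :- d) := d) refl (D i j)

      pencil-det : ∀ {t} → 0# ≤ t → t ≤ N + N → ∀ x →
        (product λ i → t - ∂ i) * (product λ i → t - ∂ i) * ∥ x ∥² ≤ κ * ∥ pencil t ⊛ x ∥²
      pencil-det {t} 0≤t t≤2N x = ≤-trans
        (≤-reflexive (*-congʳ (*-cong (sym (factorisation t)) (sym (factorisation t)))))
        (coercivity {A = pencil t} 1≤C (pencil-entries 0≤t t≤2N) x)

      -- Each gap g may depend on the eigenvalue but not on t; their product bounds the squared
      -- determinant from below on the whole interval. So one δ serves all t, as a descent by steps
      -- of fixed length demands.
      pencil-coercive : ∀ {a b} → 0# ≤ a → b ≤ N + N →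
        (∀ i → ∃ λ g → 0# < g × (∀ {t} → a ≤ t → t ≤ b → g ≤ (t - ∂ i) * (t - ∂ i))) →
        ∃ λ δ → 0# < δ × (∀ {t} → a ≤ t → t ≤ b → ∀ x → δ * ∥ x ∥² ≤ ∥ pencil t ⊛ x ∥²)
      pencil-coercive {a} {b} 0≤a b≤2N separation = product g * u , *-positive 0<∏g 0<u , bound
        where
        g : Vector Carrier n
        g i = proj₁ (separation i)
        0<∏g : 0# < product g
        0<∏g = product-pos λ i → proj₁ (proj₂ (separation i))
        0≤κ : 0# ≤ κ
        0≤κ = *-nonNeg (fromNat-nonNeg n) (*-nonNeg (fromNat-nonNeg n) (detBound-nonNeg n (≤-trans 0≤1 1≤C)))
        -- Dividing by 1 + κ needs only that κ is nonnegative.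
        0<1+κ : 0# < 1# + κ
        0<1+κ = +-pos-nonNeg 0<1 0≤κ
        u = proj₁ (inverse-pos 0<1+κ)
        0<u = proj₁ (proj₂ (inverse-pos 0<1+κ))
        [1+κ]u≈1 = proj₂ (proj₂ (inverse-pos 0<1+κ))
        bound : ∀ {t} → a ≤ t → t ≤ b → ∀ x → product g * u * ∥ x ∥² ≤ ∥ pencil t ⊛ x ∥²
        bound {t} a≤t t≤b x = *-cancelˡ-≤ 0<1+κ (≤-trans
          (≤-reflexive (trans (solve 4 (λ k g u q → k :* (g :* u :* q) := k :* u :* (g :* q)) refl (1# + κ) (product g) u ∥ x ∥²)
            (trans (*-congʳ [1+κ]u≈1) (*-identityˡ _))))
          (≤-trans (*-monoʳ-≤ (∥∥²-nonNeg x) (product-square-≤ (λ i → proj₁ (proj₂ (separation i)))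
              (λ i → proj₂ (proj₂ (separation i)) a≤t t≤b)))
            (≤-trans (pencil-det (≤-trans 0≤a a≤t) (≤-trans t≤b b≤2N) x)
              (≤-by (∥∥²-nonNeg (pencil t ⊛ x)) (solve 2 (λ k q → (con (ℤ.+ 1) :+ k) :* q :- k :* q := q) refl κ ∥ pencil t ⊛ x ∥²)))))

      private
        gap-impossible : ∀ {δ T q p} → 0# < δ → 0# < T → 0# < q → p ≤ 0# → ¬ (δ * q ≤ T * p)
        gap-impossible {T = T} 0<δ 0<T 0<q p≤0 δq≤Tp = ≤-trans δq≤Tp
          (≤-trans (*-monoˡ-≤ (<⇒≤ 0<T) p≤0) (≤-reflexive (zeroʳ T))) (*-positive 0<δ 0<q)

      neg : Matrix n
      neg i j = - L i j

      neg-⊛ : ∀ x i → (neg ⊛ x) i ≈ - (L ⊛ x) i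
      neg-⊛ x i = begin
        sum (λ j → - L i j * x j)
          ≈⟨ sum-cong-≋ (λ j → solve 2 (λ l x → :- l :* x := :- con (ℤ.+ 1) :* (l :* x)) refl (L i j) (x j)) ⟩
        sum (λ j → - 1# * (L i j * x j))    ≈⟨ *-distribˡ-sum (- 1#) (λ j → L i j * x j) ⟨
        - 1# * (L ⊛ x) i                    ≈⟨ solve 1 (λ a → :- con (ℤ.+ 1) :* a := :- a) refl ((L ⊛ x) i) ⟩
        - (L ⊛ x) i                         ∎

      neg-form : ∀ s x → form neg s x ≈ s * ∥ x ∥² - x ∙ L ⊛ x
      neg-form s x = begin
        form neg s x
          ≈⟨ ∙-congʳ x (λ i → trans (+-congʳ (neg-⊛ x i)) (solve 3 (λ l s x → :- l :+ s :* x := :- con (ℤ.+ 1) :* l :+ s :* x) refl ((L ⊛ x) i) s (x i))) ⟩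
        x ∙ (λ i → - 1# * (L ⊛ x) i + s * x i)   ≈⟨ ∙-combinationʳ (- 1#) s x (L ⊛ x) x ⟩
        - 1# * (x ∙ L ⊛ x) + s * ∥ x ∥²
          ≈⟨ solve 2 (λ a b → :- con (ℤ.+ 1) :* a :+ b := b :- a) refl (x ∙ L ⊛ x) (s * ∥ x ∥²) ⟩
        s * ∥ x ∥² - x ∙ L ⊛ x                   ∎

      -- No eigenvalue meets the interval from λ⁺ to 2n, each being at least λ⁺ - top away, so the
      -- descent for -L makes the form of λ⁺ - L strictly positive at x. The bound T = 2n holds at
      -- the start because the form of L is nonnegative.
      form-<-top : ∀ {top} → (∀ i → ∂ i ≤ top) → ∀ {λ⁺} → 0# ≤ λ⁺ → λ⁺ ≤ N + N → top < λ⁺ →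
        ∀ {x} → sum x ≈ 0# → 0# < ∥ x ∥² → ¬ (λ⁺ * ∥ x ∥² ≤ x ∙ L ⊛ x)
      form-<-top {top} ∂≤top {λ⁺} 0≤λ⁺ λ⁺≤2N top<λ⁺ {x} ∑x≈0 0<∥x∥² λ⁺∥x∥²≤ = gap-impossible 0<δ 0<2N 0<∥x∥² form≤0
        (descent {A = neg} (λ i j → -‿cong (L-sym i j))
          (λ i → trans (sum-cong-≋ λ j → sym (*-identityʳ (neg i j))) (trans (neg-⊛ (λ _ → 1#) i)
            (trans (-‿cong (trans (sum-cong-≋ λ j → *-identityʳ (L i j)) (L-rowSums i))) (solve 0 (:- con (ℤ.+ 0) := con (ℤ.+ 0)) refl))))
          λ⁺≤2N 0<2N 0<δ
          (λ {x} ∑x≈0 → ≤-trans (≤-reflexive (neg-form (N + N) x)) (≤-by (≤-trans (*-nonNeg (fromNat-nonNeg n) (∥∥²-nonNeg x)) (L-lower ∑x≈0))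
            (solve 2 (λ a b → a :- (a :- b) := b) refl ((N + N) * ∥ x ∥²) (x ∙ L ⊛ x))))
          (λ {x} ∑x≈0 → ≤-trans (x≤y⇒0≤y-x (L-upper ∑x≈0)) (≤-reflexive (sym (neg-form (N + N) x))))
          (λ {s} lo≤s s≤hi {x} _ → ≤-trans (bound lo≤s s≤hi x) (≤-reflexive (shift-pencil s x)))
          ∑x≈0)
        where
        separation : ∀ i → ∃ λ g → 0# < g × (∀ {t} → λ⁺ ≤ t → t ≤ N + N → g ≤ (t - ∂ i) * (t - ∂ i))
        separation i = (λ⁺ - top) * (λ⁺ - top) , *-positive (x<y⇒0<y-x top<λ⁺) (x<y⇒0<y-x top<λ⁺) ,
          λ {t} λ⁺≤t _ → square-mono-≤ (<⇒≤ (x<y⇒0<y-x top<λ⁺)) (≤-by (+-nonNeg (x≤y⇒0≤y-x λ⁺≤t) (x≤y⇒0≤y-x (∂≤top i)))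
            (solve 4 (λ l s t d → t :- d :- (l :- s) := t :- l :+ (s :- d)) refl λ⁺ top t (∂ i)))
        coercive = pencil-coercive 0≤λ⁺ ≤-refl separation
        δ = proj₁ coercive
        0<δ = proj₁ (proj₂ coercive)
        bound = proj₂ (proj₂ coercive)
        shift-pencil : ∀ s x → ∥ pencil s ⊛ x ∥² ≈ ∥ shift neg s x ∥²
        shift-pencil s x = sum-cong-≋ λ i → *-cong (entry i) (entry i)
          where
          entry : ∀ i → (pencil s ⊛ x) i ≈ shift neg s x i
          entry i = trans (pencil-⊛ s x i) (trans (+-comm _ _) (+-congʳ (sym (neg-⊛ x i))))
        form≤0 : form neg λ⁺ x ≤ 0#
        form≤0 = ≤-trans (≤-reflexive (neg-form λ⁺ x)) (≤-by (x≤y⇒0≤y-x λ⁺∥x∥²≤)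
          (solve 2 (λ a b → con (ℤ.+ 0) :- (a :- b) := b :- a) refl (λ⁺ * ∥ x ∥²) (x ∙ L ⊛ x)))

      -- The all-ones vector lies in the kernel of L, whereas eigenvalues all apart from 0 would
      -- make -L injective by Cramer's rule. The negative form avoids having to exhibit the index of
      -- a vanishing eigenvalue.
      zero-eigenvalue : ¬ (∀ i → ∂ i # 0#)
      zero-eigenvalue ∂#0 = ≤-trans
        (*-monoʳ-≤ (∥∥²-nonNeg 𝟏) (product-square-≤ {f = λ i → 0# - ∂ i} 0<∂² ∂²≤))
        (≤-trans (pencil-det ≤-refl 0≤2N 𝟏)
          (≤-reflexive (trans (*-congˡ (sum-zero λ i → trans (*-congʳ (kernel i)) (zeroˡ _))) (zeroʳ κ))))
        (*-positive (product-pos 0<∂²) 0<∥𝟏∥²)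
        where
        𝟏 : Vector Carrier n
        𝟏 _ = 1#
        0<∂² : ∀ i → 0# < ∂ i * ∂ i
        0<∂² i = square-pos (∂#0 i)
        ∂²≤ : ∀ i → ∂ i * ∂ i ≤ (0# - ∂ i) * (0# - ∂ i)
        ∂²≤ i = ≤-reflexive (solve 1 (λ d → d :* d := (con (ℤ.+ 0) :- d) :* (con (ℤ.+ 0) :- d)) refl (∂ i))
        kernel : ∀ i → (pencil 0# ⊛ 𝟏) i ≈ 0#
        kernel i = trans (pencil-⊛ 0# 𝟏 i) (trans (+-cong (zeroˡ 1#) (-‿cong
          (trans (sum-cong-≋ λ j → *-identityʳ (L i j)) (L-rowSums i)))) (-‿inverseʳ 0#))
        0<∥𝟏∥² : 0# < ∥ 𝟏 ∥²
        0<∥𝟏∥² = <-≤-trans (<-≤-trans 0<1 1≤n) (≤-reflexive (sym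
          (trans (sum-const n (1# * 1#)) (trans (*-congˡ (*-identityˡ 1#)) (*-identityʳ N)))))

      -- Here t = -s climbs from n to μ while the shift s of L falls from -n to -μ. Eigenvalues
      -- other than the j-th lie beyond μ by at least bottom - μ; the j-th is 0, at distance at
      -- least n from the interval.
      form->-bottom : ∀ {j bottom} → (∀ i → i ≢ j → bottom ≤ ∂ i) → ∀ {μ} → N ≤ μ → μ ≤ N + N → μ < bottom →
        ∀ {x} → sum x ≈ 0# → 0# < ∥ x ∥² → ¬ (x ∙ L ⊛ x ≤ μ * ∥ x ∥²)
      form->-bottom {j} {bottom} bottom≤∂ {μ} N≤μ μ≤2N μ<bottom {x} ∑x≈0 0<∥x∥² ≤μ∥x∥² = gap-impossible 0<δ 0<2N 0<∥x∥² form≤0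
        (descent {A = L} L-sym L-rowSums
          (≤-by (x≤y⇒0≤y-x N≤μ) (solve 2 (λ a b → :- a :- :- b := b :- a) refl N μ)) 0<2N 0<δ
          (λ {x} ∑x≈0 → ≤-trans (≤-reflexive (form-expand (- N) x)) (≤-trans
            (≤-by (*-nonNeg (fromNat-nonNeg n) (∥∥²-nonNeg x)) (solve 3 (λ p N q → p :- (p :+ :- N :* q) := N :* q) refl (x ∙ L ⊛ x) N ∥ x ∥²))
            (L-upper ∑x≈0)))
          (λ {x} ∑x≈0 → ≤-trans (x≤y⇒0≤y-x (L-lower ∑x≈0)) (≤-reflexive (trans
            (solve 3 (λ p N q → p :- N :* q := p :+ :- N :* q) refl (x ∙ L ⊛ x) N ∥ x ∥²) (sym (form-expand (- N) x)))))
          (λ {s} lo≤s s≤hi {x} _ → ≤-trans (bound {t = - s}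
              (≤-by (x≤y⇒0≤y-x s≤hi) (solve 2 (λ s N → :- s :- N := :- N :- s) refl s N))
              (≤-by (x≤y⇒0≤y-x lo≤s) (solve 2 (λ s m → m :- :- s := s :- :- m) refl s μ)) x)
            (≤-reflexive (shift-pencil s x)))
          ∑x≈0)
        where
        0<N : 0# < N
        0<N = <-≤-trans 0<1 1≤n
        -- The other eigenvalues are at least bottom, which exceeds μ ≥ n > 0. Were the j-th apart
        -- from 0, all would be; tightness turns this refutation into an equality.
        ∂ⱼ≈0 : ∂ j ≈ 0#
        ∂ⱼ≈0 = ¬#0⇒≈0 λ ∂ⱼ#0 → zero-eigenvalue (∂#0 ∂ⱼ#0)
          where
          ∂#0 : ∂ j # 0# → ∀ i → ∂ i # 0#
          ∂#0 ∂ⱼ#0 i with i ≟ j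
          ... | yes ≡.refl = ∂ⱼ#0
          ... | no  i≢j    = #-sym (<⇒# (<-≤-trans (<-trans (<-≤-trans 0<N N≤μ) μ<bottom) (bottom≤∂ i i≢j)))
        separation : ∀ i → ∃ λ g → 0# < g × (∀ {t} → N ≤ t → t ≤ μ → g ≤ (t - ∂ i) * (t - ∂ i))
        separation i with i ≟ j
        ... | yes ≡.refl = N * N , *-positive 0<N 0<N , λ {t} N≤t _ → square-mono-≤ (<⇒≤ 0<N)
          (≤-trans N≤t (≤-reflexive (trans (solve 1 (λ t → t := t :- con (ℤ.+ 0)) refl t) (+-congˡ (-‿cong (sym ∂ⱼ≈0))))))
        ... | no  i≢j    = (bottom - μ) * (bottom - μ) , *-positive (x<y⇒0<y-x μ<bottom) (x<y⇒0<y-x μ<bottom) ,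
          λ {t} _ t≤μ → ≤-trans (square-mono-≤ (<⇒≤ (x<y⇒0<y-x μ<bottom)) (≤-by (+-nonNeg (x≤y⇒0≤y-x t≤μ) (x≤y⇒0≤y-x (bottom≤∂ i i≢j)))
            (solve 4 (λ m b t d → d :- t :- (b :- m) := m :- t :+ (d :- b)) refl μ bottom t (∂ i))))
            (≤-reflexive (solve 2 (λ t d → (d :- t) :* (d :- t) := (t :- d) :* (t :- d)) refl t (∂ i)))
        coercive = pencil-coercive (<⇒≤ 0<N) μ≤2N separation
        δ = proj₁ coercive
        0<δ = proj₁ (proj₂ coercive)
        bound = proj₂ (proj₂ coercive)
        shift-pencil : ∀ s x → ∥ pencil (- s) ⊛ x ∥² ≈ ∥ shift L s x ∥²
        shift-pencil s x = sum-cong-≋ λ i → trans (*-cong (pencil-⊛ (- s) x i) (pencil-⊛ (- s) x i))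
          (solve 3 (λ s x l → (:- s :* x :- l) :* (:- s :* x :- l) := (l :+ s :* x) :* (l :+ s :* x)) refl s (x i) ((L ⊛ x) i))
        form≤0 : form L (- μ) x ≤ 0#
        form≤0 = ≤-trans (≤-reflexive (form-expand (- μ) x)) (≤-by (x≤y⇒0≤y-x ≤μ∥x∥²)
          (solve 3 (λ p m q → con (ℤ.+ 0) :- (p :+ :- m :* q) := m :* q :- p) refl (x ∙ L ⊛ x) μ ∥ x ∥²))

-- Subsets, and graphs of diameter two.

∣p∣≥1⇒nonempty : ∀ {n} (p : Subset n) → 1 ℕ.≤ ∣ p ∣ → ∃ (_∈ p)
∣p∣≥1⇒nonempty (inside  ∷ p) _     = zero , here
∣p∣≥1⇒nonempty (outside ∷ p) 1≤∣p∣ with ∣p∣≥1⇒nonempty p 1≤∣p∣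
... | v , v∈p = suc v , there v∈p

∣p∣≥2⇒distinct : ∀ {n} (p : Subset n) → 2 ℕ.≤ ∣ p ∣ → ∃₂ λ u v → u ∈ p × v ∈ p × u ≢ v
∣p∣≥2⇒distinct (inside ∷ p) (ℕ.s≤s 1≤∣p∣) with ∣p∣≥1⇒nonempty p 1≤∣p∣
... | v , v∈p = zero , suc v , here , there v∈p , λ ()
∣p∣≥2⇒distinct (outside ∷ p) 2≤∣p∣ with ∣p∣≥2⇒distinct p 2≤∣p∣
... | u , v , u∈p , v∈p , u≢v = suc u , suc v , there u∈p , there v∈p , λ { ≡.refl → u≢v ≡.refl }

∣⁅u⁆∪⁅v⁆∣≥2 : ∀ {n} {u v : Fin n} → u ≢ v → 2 ℕ.≤ ∣ ⁅ u ⁆ ∪ ⁅ v ⁆ ∣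
∣⁅u⁆∪⁅v⁆∣≥2 {u = u} {v} u≢v = ℕ.≤-trans
  (ℕ.s≤s (ℕ.≤-trans (ℕ.s≤s ℕ.z≤n) (x∈p⇒∣p-x∣<∣p∣ v∈))) (x∈p⇒∣p-x∣<∣p∣ u∈)
  where
  u∈ : u ∈ ⁅ u ⁆ ∪ ⁅ v ⁆
  u∈ = x∈p∪q⁺ (inj₁ (x∈⁅x⁆ u))
  v∈ : v ∈ (⁅ u ⁆ ∪ ⁅ v ⁆) Subset.- u
  v∈ = x∈p∧x≢y⇒x∈p-y (x∈p∪q⁺ (inj₂ (x∈⁅x⁆ v))) (u≢v ∘ ≡.sym)

module DiameterTwo {n : ℕ} (G : Graph n) (conn : Connected G) (diam : IsDiameter G conn 2) where
  open Graph G

  distance-isLeast : ∀ u v → IsLeast (λ k → Walk G k u v) (distance G conn u v)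
  distance-isLeast u v with conn u v
  ... | b , walk = proj₂ (least (λ k → walk? G k u v) b walk)

  data Distance (u v : Fin n) : ℕ → Set where
    same     : u ≡ v → Distance u v 0
    adjacent : u ≢ v → u ~ v → Distance u v 1
    far      : u ≢ v → ¬ (u ~ v) → Distance u v 2

  distance-view : ∀ u v → Distance u v (distance G conn u v)
  distance-view u v with distance G conn u v | distance-isLeast u v | proj₂ diam _ (u , v , ≡.refl)
  ... | 0 | u≡v , _ | _ = same u≡v
  ... | 1 | (w , u~w , ≡.refl) , _ | _ = adjacent (λ u≡v → ~-irrefl u≡v u~w) u~w
  ... | 2 | _ , minimal | _ = far
    (λ u≡v → contradiction (minimal 0 u≡v) λ ())
    (λ u~v → contradiction (minimal 1 (v , u~v , ≡.refl)) λ { (ℕ.s≤s ()) })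
  ... | suc (suc (suc _)) | _ | ℕ.s≤s (ℕ.s≤s ())

  -- Gives symmetry of the distance without reversing walks: the view is determined by equality and
  -- adjacency, and both are symmetric.
  distance-unique : ∀ {u v j k} → Distance u v j → Distance v u k → j ≡ k
  distance-unique (same _)         (same _)         = ≡.refl
  distance-unique (same u≡v)       (adjacent v≢u _) = contradiction (≡.sym u≡v) v≢u
  distance-unique (same u≡v)       (far v≢u _)      = contradiction (≡.sym u≡v) v≢u
  distance-unique (adjacent u≢v _) (same v≡u)       = contradiction (≡.sym v≡u) u≢v
  distance-unique (adjacent _ _)   (adjacent _ _)   = ≡.refl
  distance-unique (adjacent _ u~v) (far _ v≁u)      = contradiction (~-sym u~v) v≁u
  distance-unique (far u≢v _)      (same v≡u)       = contradiction (≡.sym v≡u) u≢v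
  distance-unique (far _ u≁v)      (adjacent _ v~u) = contradiction (~-sym v~u) u≁v
  distance-unique (far _ _)        (far _ _)        = ≡.refl

  distance-sym : ∀ u v → distance G conn u v ≡ distance G conn v u
  distance-sym u v = distance-unique (distance-view u v) (distance-view v u)

  distance≡2 : ∀ {u v} → u ≢ v → ¬ (u ~ v) → distance G conn u v ≡ 2
  distance≡2 {u} {v} u≢v u≁v with distance G conn u v | distance-view u v
  ... | _ | same u≡v       = contradiction u≡v u≢v
  ... | _ | adjacent _ u~v = contradiction u~v u≁v
  ... | _ | far _ _        = ≡.refl

  far-pair : ∃₂ λ u v → u ≢ v × ¬ (u ~ v)
  far-pair with proj₁ diam
  ... | u , v , d≡2 = u , v , split d≡2 (distance-view u v)
    where
    split : ∀ {k} → k ≡ 2 → Distance u v k → u ≢ v × ¬ (u ~ v)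
    split _ (far u≢v u≁v) = u≢v , u≁v

  -- A walk of length two has a first edge. The bound keeps the star vector from being zero.
  maxDegree≥1 : ∀ {Δ} → IsMaxDegree G Δ → 1 ℕ.≤ Δ
  maxDegree≥1 (_ , maximal) with proj₁ diam
  ... | u , v , d≡2 with ≡.subst (λ k → Walk G k u v) d≡2 (proj₁ (distance-isLeast u v))
  ... | w , u~w , _ = ℕ.≤-trans (ℕ.≤-trans (ℕ.s≤s ℕ.z≤n) (x∈p⇒∣p-x∣<∣p∣ w∈)) (maximal _ (u , ≡.refl))
    where
    w∈ : w ∈ neighbours G u
    w∈ = lookup⇒[]= w (neighbours G u)
      (≡.trans (lookup∘tabulate (λ w → does (u ~? w)) w) (dec-true (u ~? w) u~w))

  distance≡1 : ∀ {u v} → u ~ v → distance G conn u v ≡ 1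
  distance≡1 {u} {v} u~v with distance G conn u v | distance-view u v
  ... | _ | same u≡v     = contradiction u~v (~-irrefl u≡v)
  ... | _ | adjacent _ _ = ≡.refl
  ... | _ | far _ u≁v    = contradiction u~v u≁v

  -- Two vertices at distance two form an independent set. A maximum independent set therefore
  -- contains the two distinct vertices that the test vector requires.
  independenceNumber≥2 : ∀ {α} → IsIndependenceNumber G α → 2 ℕ.≤ α
  independenceNumber≥2 (_ , maximal) with far-pair
  ... | u , v , u≢v , u≁v = ℕ.≤-trans (∣⁅u⁆∪⁅v⁆∣≥2 u≢v) (maximal _ (⁅ u ⁆ ∪ ⁅ v ⁆ , independent , ≡.refl))
    where
    independent : Independent G (⁅ u ⁆ ∪ ⁅ v ⁆)
    independent {x} {y} x∈ y∈ with x∈p∪q⁻ ⁅ u ⁆ ⁅ v ⁆ x∈ | x∈p∪q⁻ ⁅ u ⁆ ⁅ v ⁆ y∈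
    ... | inj₁ p | inj₁ q rewrite x∈⁅y⁆⇒x≡y u p | x∈⁅y⁆⇒x≡y u q = ~-irrefl ≡.refl
    ... | inj₁ p | inj₂ q rewrite x∈⁅y⁆⇒x≡y u p | x∈⁅y⁆⇒x≡y v q = u≁v
    ... | inj₂ p | inj₁ q rewrite x∈⁅y⁆⇒x≡y v p | x∈⁅y⁆⇒x≡y u q = u≁v ∘ ~-sym
    ... | inj₂ p | inj₂ q rewrite x∈⁅y⁆⇒x≡y v p | x∈⁅y⁆⇒x≡y v q = ~-irrefl ≡.refl

-- The two test vectors and the bounds they give.

module SpreadBound {c ℓ₁ ℓ₂ ℓ₃ : Level} (ℝ : RealField c ℓ₁ ℓ₂ ℓ₃) where
  open RealField ℝ hiding (zero)
  open Spectra ℝ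
  open WeightedLaplacian ℝ
  open Solver
  open SetoidReasoning setoid

  private
    ℕ-sum : ∀ {n} → Vector ℕ n → ℕ
    ℕ-sum = RawSemiringDefinitions.sum ℕ.+-*-rawSemiring

  fromNat-sum : ∀ {n} (f : Vector ℕ n) → fromNat (ℕ-sum f) ≈ sum (fromNat ∘ f)
  fromNat-sum {zero}  f = refl
  fromNat-sum {suc n} f = trans (×-homo-+ 1# (f zero) (ℕ-sum (f ∘ suc))) (+-congˡ (fromNat-sum (f ∘ suc)))

  indicator : Bool → Carrier
  indicator b = if b then 1# else 0#

  indicator-≤1 : ∀ b → indicator b ≤ 1#
  indicator-≤1 true  = ≤-refl
  indicator-≤1 false = 0≤1

  fromNat-∣p∣ : ∀ {n} (p : Subset n) → fromNat ∣ p ∣ ≈ sum λ i → indicator (lookup p i)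
  fromNat-∣p∣ []            = refl
  fromNat-∣p∣ (inside  ∷ p) = +-congˡ (fromNat-∣p∣ p)
  fromNat-∣p∣ (outside ∷ p) = trans (fromNat-∣p∣ p) (sym (+-identityˡ _))

  unit : ∀ {n} → Fin n → Vector Carrier n
  unit = diag λ _ → 1#

  unit-∙ : ∀ {n} (u : Fin n) y → unit u ∙ y ≈ y u
  unit-∙ u y = trans (diag-⊛ (λ _ → 1#) y u) (*-identityˡ (y u))

  unit-sum : ∀ {n} (u : Fin n) → sum (unit u) ≈ 1#
  unit-sum u = trans (sum-cong-≋ λ i → sym (*-identityʳ (unit u i))) (unit-∙ u λ _ → 1#)

  module _ {n} (G : Graph n) (conn : Connected G) (diam : IsDiameter G conn 2) where
    open Graph G
    open DiameterTwo G conn diam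

    private
      N = fromNat n
      τ : Vector Carrier n
      τ w = fromNat (transmission G conn w)

    D : Matrix n
    D u v = fromNat (distance G conn u v)

    D-sym : SymmetricMatrix D
    D-sym u v = reflexive (≡.cong fromNat (distance-sym u v))

    D-diag : ∀ u → D u u ≈ 0#
    D-diag u with distance G conn u u | distance-view u u
    ... | _ | same _         = refl
    ... | _ | adjacent u≢u _ = contradiction ≡.refl u≢u
    ... | _ | far u≢u _      = contradiction ≡.refl u≢u

    1≤D : ∀ {u v} → u ≢ v → 1# ≤ D u v
    1≤D {u} {v} u≢v with distance G conn u v | distance-view u v
    ... | _ | same u≡v     = contradiction u≡v u≢v
    ... | _ | adjacent _ _ = ≤-reflexive (sym (+-identityʳ 1#))
    ... | _ | far _ _      = x≤x+y (fromNat-nonNeg 1)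

    D≤2 : ∀ u v → D u v ≤ 1# + 1#
    D≤2 u v with distance G conn u v | distance-view u v
    ... | _ | same _       = +-nonNeg 0≤1 0≤1
    ... | _ | adjacent _ _ = +-mono-≤ ≤-refl 0≤1
    ... | _ | far _ _      = ≤-reflexive (+-congˡ (+-identityʳ 1#))

    τ≈∑D : ∀ u → τ u ≈ sum (D u)
    τ≈∑D u = trans (fromNat-sum λ w → distance G conn w u) (sum-cong-≋ λ w → D-sym w u)

    open Laplacian D D-sym D-diag 1≤D D≤2 τ τ≈∑D renaming (L to M)

    1≤n : 1# ≤ N
    1≤n = inhabited (proj₁ far-pair)
      where
      inhabited : ∀ {k} → Fin k → 1# ≤ fromNat k
      inhabited {suc k} _ = x≤x+y (fromNat-nonNeg k)

    -- Every w other than u is at distance at least 1, and at distance 2 if it belongs to S. The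
    -- summand 2 pays for w = u, which counts twice on the left and contributes distance 0.
    independent-transmission : ∀ {S u} → Independent G S → u ∈ S →
      N + fromNat ∣ S ∣ ≤ τ u + (1# + 1#)
    independent-transmission {S} {u} independent u∈S = ≤-trans
      (≤-reflexive (begin
        N + fromNat ∣ S ∣
          ≈⟨ +-cong (trans (sym (*-identityʳ N)) (sym (sum-const n 1#))) (fromNat-∣p∣ S) ⟩
        sum {n} (λ _ → 1#) + sum χ       ≈⟨ ∑-distrib-+ (λ _ → 1#) χ ⟨
        sum (λ w → 1# + χ w)             ∎))
      (≤-trans (sum-mono-≤ term) (≤-reflexive (begin
        sum (λ w → D u w + (1# + 1#) * unit u w)     ≈⟨ ∑-distrib-+ (D u) (λ w → (1# + 1#) * unit u w) ⟩
        sum (D u) + sum (λ w → (1# + 1#) * unit u w)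
          ≈⟨ +-cong (sym (τ≈∑D u)) (sym (*-distribˡ-sum (1# + 1#) (unit u))) ⟩
        τ u + (1# + 1#) * sum (unit u)
          ≈⟨ +-congˡ (trans (*-congˡ (unit-sum u)) (*-identityʳ _)) ⟩
        τ u + (1# + 1#)                              ∎)))
      where
      χ : Vector Carrier n
      χ w = indicator (lookup S w)
      nonmember : ∀ {w} → ¬ (w ∈ S) → χ w ≈ 0#
      nonmember {w} w∉S with lookup S w in eq
      ... | true  = contradiction (lookup⇒[]= w S eq) w∉S
      ... | false = refl
      term : ∀ w → 1# + χ w ≤ D u w + (1# + 1#) * unit u w
      term w with distance G conn u w | distance-view u w
      ... | _ | same ≡.refl = ≤-trans (+-mono-≤ ≤-refl (indicator-≤1 (lookup S u))) (≤-reflexive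
        (trans (solve 0 (con (ℤ.+ 1) :+ con (ℤ.+ 1) := con (ℤ.+ 0) :+ (con (ℤ.+ 1) :+ con (ℤ.+ 1)) :* con (ℤ.+ 1)) refl)
          (+-congˡ (*-congˡ (sym (diag-at (λ _ → 1#) u))))))
      ... | _ | adjacent u≢w u~w = ≤-reflexive (trans (+-congˡ (nonmember λ w∈S → independent u∈S w∈S u~w))
        (trans (solve 0 (con (ℤ.+ 1) :+ con (ℤ.+ 0) := con (ℤ.+ 1) :+ con (ℤ.+ 0) :+ (con (ℤ.+ 1) :+ con (ℤ.+ 1)) :* con (ℤ.+ 0)) refl)
          (+-congˡ (*-congˡ (sym (diag-off (λ _ → 1#) u≢w))))))
      ... | _ | far u≢w _ = ≤-trans (+-mono-≤ ≤-refl (indicator-≤1 (lookup S w))) (≤-reflexive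
        (trans (solve 0 (con (ℤ.+ 1) :+ con (ℤ.+ 1) := con (ℤ.+ 1) :+ (con (ℤ.+ 1) :+ con (ℤ.+ 0)) :+ (con (ℤ.+ 1) :+ con (ℤ.+ 1)) :* con (ℤ.+ 0)) refl)
          (+-congˡ (*-congˡ (sym (diag-off (λ _ → 1#) u≢w))))))

    difference : Fin n → Fin n → Vector Carrier n
    difference u v i = 1# * unit u i + - 1# * unit v i

    difference-∙ : ∀ u v y → difference u v ∙ y ≈ y u - y v
    difference-∙ u v y = trans (∙-combinationˡ 1# (- 1#) y (unit u) (unit v))
      (trans (+-cong (*-congˡ (unit-∙ u y)) (*-congˡ (unit-∙ v y)))
        (solve 2 (λ a b → con (ℤ.+ 1) :* a :+ :- con (ℤ.+ 1) :* b := a :- b) refl (y u) (y v)))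

    difference-sum : ∀ u v → sum (difference u v) ≈ 0#
    difference-sum u v = trans (sum-cong-≋ λ i → sym (*-identityʳ (difference u v i)))
      (trans (difference-∙ u v λ _ → 1#) (-‿inverseʳ 1#))

    ∥difference∥² : ∀ {u v} → u ≢ v → ∥ difference u v ∥² ≈ 1# + 1#
    ∥difference∥² {u} {v} u≢v = trans (difference-∙ u v (difference u v)) (trans
      (+-cong (+-cong (*-congˡ (diag-at (λ _ → 1#) u)) (*-congˡ (diag-off (λ _ → 1#) (u≢v ∘ ≡.sym))))
        (-‿cong (+-cong (*-congˡ (diag-off (λ _ → 1#) u≢v)) (*-congˡ (diag-at (λ _ → 1#) v)))))
      (solve 0 (con (ℤ.+ 1) :* con (ℤ.+ 1) :+ :- con (ℤ.+ 1) :* con (ℤ.+ 0) :- (con (ℤ.+ 1) :* con (ℤ.+ 0) :+ :- con (ℤ.+ 1) :* con (ℤ.+ 1))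
                := con (ℤ.+ 1) :+ con (ℤ.+ 1)) refl))

    -- Grouped so that `independent-transmission` bounds each half by n + α. The squared norm being
    -- 2, the quotient is the mean of the halves.
    difference-form : ∀ {u v} → u ≢ v → ¬ (u ~ v) →
      difference u v ∙ M ⊛ difference u v ≈ τ u + (1# + 1#) + (τ v + (1# + 1#))
    difference-form {u} {v} u≢v u≁v = begin
      difference u v ∙ M ⊛ difference u v
        ≈⟨ difference-∙ u v (M ⊛ difference u v) ⟩
      M u ∙ difference u v - M v ∙ difference u v
        ≈⟨ +-cong (row u) (-‿cong (row v)) ⟩
      M u u - M u v - (M v u - M v v)
        ≈⟨ +-cong (+-cong (Mdiag u) (-‿cong (Moff u≢v u≁v))) (-‿cong (+-cong (Moff (u≢v ∘ ≡.sym) (u≁v ∘ ~-sym)) (-‿cong (Mdiag v)))) ⟩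
      τ u - (- (1# + 1#)) - (- (1# + 1#) - τ v)
        ≈⟨ solve 3 (λ a b t → a :- :- t :- (:- t :- b) := a :+ t :+ (b :+ t)) refl (τ u) (τ v) (1# + 1#) ⟩
      τ u + (1# + 1#) + (τ v + (1# + 1#)) ∎
      where
      row : ∀ w → M w ∙ difference u v ≈ M w u - M w v
      row w = trans (∙-comm (M w) (difference u v)) (difference-∙ u v (M w))
      Mdiag : ∀ w → M w w ≈ τ w
      Mdiag = L-diag
      Moff : ∀ {w w′} → w ≢ w′ → ¬ (w ~ w′) → M w w′ ≈ - (1# + 1#)
      Moff w≢w′ w≁w′ = trans (L-off w≢w′)
        (-‿cong (trans (reflexive (≡.cong fromNat (distance≡2 w≢w′ w≁w′))) (+-congˡ (+-identityʳ 1#))))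

    module Star (v : Fin n) where
      private
        k = fromNat (degree G v)
        a e : Vector Carrier n
        a i = indicator (does (v ~? i))
        e = unit v

      star : Vector Carrier n
      star i = k * e i + - 1# * a i

      -- Each role fixes the values of e and a at i. Substituting them leaves polynomial identities
      -- in k alone.
      data Role (i : Fin n) : Set (c ⊔ ℓ₁) where
        centre : i ≡ v → e i ≈ 1# → a i ≈ 0# → Role i
        leaf   : v ~ i → e i ≈ 0# → a i ≈ 1# → Role i
        other  : e i ≈ 0# → a i ≈ 0# → Role i

      role : ∀ i → Role i
      role i with v ≟ i | v ~? i in eq
      ... | yes ≡.refl | yes v~v = contradiction v~v (~-irrefl ≡.refl)
      ... | yes ≡.refl | no  _   = centre ≡.refl (diag-at (λ _ → 1#) v) (reflexive (≡.cong (indicator ∘ does) eq))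
      ... | no  v≢i    | yes v~i = leaf v~i (diag-off (λ _ → 1#) v≢i) (reflexive (≡.cong (indicator ∘ does) eq))
      ... | no  v≢i    | no  _   = other (diag-off (λ _ → 1#) v≢i) (reflexive (≡.cong (indicator ∘ does) eq))

      ∑a≈k : sum a ≈ k
      ∑a≈k = sym (trans (fromNat-∣p∣ (neighbours G v)) (sum-cong-≋ λ i →
        reflexive (≡.cong indicator (lookup∘tabulate (λ w → does (v ~? w)) i))))

      star-sum : sum star ≈ 0#
      star-sum = begin
        sum star                    ≈⟨ sum-combination k (- 1#) e a ⟩
        k * sum e + - 1# * sum a    ≈⟨ +-cong (*-congˡ (unit-sum v)) (*-congˡ ∑a≈k) ⟩
        k * 1# + - 1# * k
          ≈⟨ solve 1 (λ k → k :* con (ℤ.+ 1) :+ :- con (ℤ.+ 1) :* k := con (ℤ.+ 0)) refl k ⟩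
        0#                          ∎

      -- A vertex is not among its own neighbours. This places 2n - Δ - 1 at or above n, inside the
      -- range of the descent.
      degree-< : k + 1# ≤ N
      degree-< = ≤-trans
        (≤-reflexive (trans (+-cong (sym ∑a≈k) (sym (unit-sum v))) (sym (∑-distrib-+ a e))))
        (≤-trans (sum-mono-≤ (term ∘ role)) (≤-reflexive (trans (sum-const n 1#) (*-identityʳ N))))
        where
        term : ∀ {i} → Role i → a i + e i ≤ 1#
        term (centre _ e≈1 a≈0) = ≤-reflexive (trans (+-cong a≈0 e≈1) (+-identityˡ 1#))
        term (leaf _ e≈0 a≈1)   = ≤-reflexive (trans (+-cong a≈1 e≈0) (+-identityʳ 1#))
        term (other e≈0 a≈0)    = ≤-trans (≤-reflexive (trans (+-cong a≈0 e≈0) (+-identityʳ 0#))) 0≤1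

      ∥star∥² : ∥ star ∥² ≈ k * k + k
      ∥star∥² = begin
        ∥ star ∥²                             ≈⟨ sum-cong-≋ (λ i → term (role i)) ⟩
        sum (λ i → k * k * e i + 1# * a i)    ≈⟨ sum-combination (k * k) 1# e a ⟩
        k * k * sum e + 1# * sum a
          ≈⟨ +-cong (trans (*-congˡ (unit-sum v)) (*-identityʳ _)) (trans (*-identityˡ _) ∑a≈k) ⟩
        k * k + k                             ∎
        where
        star-at : ∀ {i x y} → e i ≈ x → a i ≈ y → star i ≈ k * x + - 1# * y
        star-at e≈x a≈y = +-cong (*-congˡ e≈x) (*-congˡ a≈y)
        goal : ∀ {i x y} → e i ≈ x → a i ≈ y →
          (k * x + - 1# * y) * (k * x + - 1# * y) ≈ k * k * x + 1# * y → star i * star i ≈ k * k * e i + 1# * a i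
        goal e≈x a≈y eq = trans (*-cong (star-at e≈x a≈y) (star-at e≈x a≈y))
          (trans eq (sym (+-cong (*-congˡ e≈x) (*-congˡ a≈y))))
        term : ∀ {i} → Role i → star i * star i ≈ k * k * e i + 1# * a i
        term (centre _ e≈1 a≈0) = goal e≈1 a≈0 (solve 1 (λ k → let x = con (ℤ.+ 1); y = con (ℤ.+ 0) in
          (k :* x :+ :- con (ℤ.+ 1) :* y) :* (k :* x :+ :- con (ℤ.+ 1) :* y) := k :* k :* x :+ con (ℤ.+ 1) :* y) refl k)
        term (leaf _ e≈0 a≈1)   = goal e≈0 a≈1 (solve 1 (λ k → let x = con (ℤ.+ 0); y = con (ℤ.+ 1) in
          (k :* x :+ :- con (ℤ.+ 1) :* y) :* (k :* x :+ :- con (ℤ.+ 1) :* y) := k :* k :* x :+ con (ℤ.+ 1) :* y) refl k)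
        term (other e≈0 a≈0)    = goal e≈0 a≈0 (solve 1 (λ k → let x = con (ℤ.+ 0); y = con (ℤ.+ 0) in
          (k :* x :+ :- con (ℤ.+ 1) :* y) :* (k :* x :+ :- con (ℤ.+ 1) :* y) := k :* k :* x :+ con (ℤ.+ 1) :* y) refl k)

      -- Compare with the form of constant weight 2: each edge of the graph lowers it by its squared
      -- difference, and only the edges at v are counted. Those alone save k + 1 times the squared
      -- norm.
      star-form : star ∙ M ⊛ star ≤ (N + N - (k + 1#)) * ∥ star ∥²
      star-form = double-≤ (≤-by (x≤y⇒0≤y-x doubled) (trans
        (solve 4 (λ p c N q → (N :+ N :- c) :* q :+ (N :+ N :- c) :* q :- (p :+ p)
          := (con (ℤ.+ 1) :+ con (ℤ.+ 1)) :* (N :* q) :+ (con (ℤ.+ 1) :+ con (ℤ.+ 1)) :* (N :* q) :- (p :+ p :+ (c :* q :+ c :* q)))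
          refl (star ∙ M ⊛ star) (k + 1#) N ∥ star ∥²)
        (+-cong (sym (differences-const (1# + 1#) star star-sum)) (-‿cong (+-cong (L-form star) leaves)))))
        where
        -- The values k at the centre and -1 at a leaf differ by k + 1, so K is the squared
        -- difference along a star edge. The products of a and e select these edges in both
        -- orientations.
        K = (k + 1#) * (k + 1#)
        leaves : (k + 1#) * ∥ star ∥² + (k + 1#) * ∥ star ∥² ≈
                 sum λ i → sum λ j → K * a i * e j + K * e i * a j
        leaves = sym (begin
          sum (λ i → sum λ j → K * a i * e j + K * e i * a j)
            ≈⟨ sum-cong-≋ (λ i → sum-combination (K * a i) (K * e i) e a) ⟩
          sum (λ i → K * a i * sum e + K * e i * sum a)
            ≈⟨ sum-cong-≋ (λ i → solve 5 (λ K x y s t → K :* x :* s :+ K :* y :* t := K :* s :* x :+ K :* t :* y) refl K (a i) (e i) (sum e) (sum a)) ⟩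
          sum (λ i → K * sum e * a i + K * sum a * e i)
            ≈⟨ sum-combination (K * sum e) (K * sum a) a e ⟩
          K * sum e * sum a + K * sum a * sum e
            ≈⟨ +-cong (*-cong (*-congˡ (unit-sum v)) ∑a≈k) (*-cong (*-congˡ ∑a≈k) (unit-sum v)) ⟩
          K * 1# * k + K * k * 1#
            ≈⟨ solve 1 (λ k → let c = k :+ con (ℤ.+ 1) in
                 c :* c :* con (ℤ.+ 1) :* k :+ c :* c :* k :* con (ℤ.+ 1) := c :* (k :* k :+ k) :+ c :* (k :* k :+ k)) refl k ⟩
          (k + 1#) * (k * k + k) + (k + 1#) * (k * k + k)
            ≈⟨ +-cong (*-congˡ ∥star∥²) (*-congˡ ∥star∥²) ⟨
          (k + 1#) * ∥ star ∥² + (k + 1#) * ∥ star ∥² ∎)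
        square : Fin n → Fin n → Carrier
        square i j = (star i - star j) * (star i - star j)
        term : ∀ {i j} → Role i → Role j → D i j * square i j + (K * a i * e j + K * e i * a j) ≤ (1# + 1#) * square i j
        term {i} {j} = by-role
          where
          zeroˡ′ : ∀ {x y} → x ≈ 0# → K * x * y ≈ 0#
          zeroˡ′ {x} {y} x≈0 = trans (*-congʳ (trans (*-congˡ x≈0) (zeroʳ K))) (zeroˡ y)
          zeroʳ′ : ∀ {x y} → y ≈ 0# → K * x * y ≈ 0#
          zeroʳ′ y≈0 = trans (*-congˡ y≈0) (zeroʳ _)
          -- Off the star edges there is no saving to account for, and a distance of at most 2 is
          -- enough.
          negligible : K * a i * e j ≈ 0# → K * e i * a j ≈ 0# →
            D i j * square i j + (K * a i * e j + K * e i * a j) ≤ (1# + 1#) * square i j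
          negligible p q = ≤-trans (≤-reflexive (trans (+-congˡ (trans (+-cong p q) (+-identityˡ 0#))) (+-identityʳ _)))
            (*-monoʳ-≤ (square-nonNeg _) (D≤2 i j))
          star-at : ∀ {l x y} → e l ≈ x → a l ≈ y → star l ≈ k * x + - 1# * y
          star-at e≈x a≈y = +-cong (*-congˡ e≈x) (*-congˡ a≈y)
          D≈1 : i ~ j → D i j ≈ 1#
          D≈1 i~j = trans (reflexive (≡.cong fromNat (distance≡1 i~j))) (+-identityʳ 1#)
          -- On a star edge the distance is 1, so the missing unit of weight is exactly K and
          -- equality holds.
          edge : ∀ {x y z w} → i ~ j → e i ≈ x → a i ≈ y → e j ≈ z → a j ≈ w →
            let s = k * x + - 1# * y - (k * z + - 1# * w) in
            1# * (s * s) + (K * y * z + K * x * w) ≈ (1# + 1#) * (s * s) →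
            D i j * square i j + (K * a i * e j + K * e i * a j) ≤ (1# + 1#) * square i j
          edge {x} {y} {z} {w} i~j eᵢ aᵢ eⱼ aⱼ eq = ≤-reflexive (trans
            (+-cong (*-cong (D≈1 i~j) squares) (+-cong (*-cong (*-congˡ aᵢ) eⱼ) (*-cong (*-congˡ eᵢ) aⱼ)))
            (trans eq (*-congˡ (sym squares))))
            where
            difference≈ : star i - star j ≈ k * x + - 1# * y - (k * z + - 1# * w)
            difference≈ = +-cong (star-at eᵢ aᵢ) (-‿cong (star-at eⱼ aⱼ))
            squares = *-cong difference≈ difference≈
          by-role : Role i → Role j → D i j * square i j + (K * a i * e j + K * e i * a j) ≤ (1# + 1#) * square i j
          by-role (centre ≡.refl eᵢ aᵢ) (leaf v~j eⱼ aⱼ) = edge v~j eᵢ aᵢ eⱼ aⱼ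
            (solve 1 (λ k → let x = con (ℤ.+ 1) ; y = con (ℤ.+ 0) ; z = con (ℤ.+ 0) ; w = con (ℤ.+ 1)
                                s = k :* x :+ :- con (ℤ.+ 1) :* y :- (k :* z :+ :- con (ℤ.+ 1) :* w)
                                K = (k :+ con (ℤ.+ 1)) :* (k :+ con (ℤ.+ 1)) in
              con (ℤ.+ 1) :* (s :* s) :+ (K :* y :* z :+ K :* x :* w) := (con (ℤ.+ 1) :+ con (ℤ.+ 1)) :* (s :* s)) refl k)
          by-role (leaf v~i eᵢ aᵢ) (centre ≡.refl eⱼ aⱼ) = edge (~-sym v~i) eᵢ aᵢ eⱼ aⱼ
            (solve 1 (λ k → let x = con (ℤ.+ 0) ; y = con (ℤ.+ 1) ; z = con (ℤ.+ 1) ; w = con (ℤ.+ 0)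
                                s = k :* x :+ :- con (ℤ.+ 1) :* y :- (k :* z :+ :- con (ℤ.+ 1) :* w)
                                K = (k :+ con (ℤ.+ 1)) :* (k :+ con (ℤ.+ 1)) in
              con (ℤ.+ 1) :* (s :* s) :+ (K :* y :* z :+ K :* x :* w) := (con (ℤ.+ 1) :+ con (ℤ.+ 1)) :* (s :* s)) refl k)
          by-role (centre _ _ aᵢ) (centre _ _ aⱼ) = negligible (zeroˡ′ aᵢ) (zeroʳ′ aⱼ)
          by-role (centre _ _ aᵢ) (other _ aⱼ)    = negligible (zeroˡ′ aᵢ) (zeroʳ′ aⱼ)
          by-role (leaf _ eᵢ _)   (leaf _ eⱼ _)   = negligible (zeroʳ′ eⱼ) (zeroˡ′ eᵢ)
          by-role (leaf _ eᵢ _)   (other eⱼ _)    = negligible (zeroʳ′ eⱼ) (zeroˡ′ eᵢ)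
          by-role (other eᵢ aᵢ)   _               = negligible (zeroˡ′ aᵢ) (zeroˡ′ eᵢ)
        doubled : differences D star + sum (λ i → sum λ j → K * a i * e j + K * e i * a j) ≤
                  differences (λ _ _ → 1# + 1#) star
        doubled = ≤-trans (≤-reflexive (begin
          differences D star + sum (λ i → sum λ j → K * a i * e j + K * e i * a j)
            ≈⟨ ∑-distrib-+ (λ i → sum λ j → D i j * square i j) (λ i → sum λ j → K * a i * e j + K * e i * a j) ⟨
          sum (λ i → sum (λ j → D i j * square i j) + sum λ j → K * a i * e j + K * e i * a j)
            ≈⟨ sum-cong-≋ (λ i → ∑-distrib-+ (λ j → D i j * square i j) (λ j → K * a i * e j + K * e i * a j)) ⟨
          sum (λ i → sum λ j → D i j * square i j + (K * a i * e j + K * e i * a j)) ∎))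
          (sum-mono-≤ λ i → sum-mono-≤ λ j → term (role i) (role j))

    open Spectrum 1≤n

    module _ {∂ : Vector Carrier n} (spectrum : IsSpectrum (distanceLaplacian G conn) ∂) where

      independence-bound : ∀ {α} → IsIndependenceNumber G α → ∀ {top} → (∀ i → ∂ i ≤ top) →
        N + fromNat α ≤ top
      independence-bound isα@((S , independent , ≡.refl) , _) {top} ∂≤top top<N+α
        with ∣p∣≥2⇒distinct S (independenceNumber≥2 isα)
      ... | u , v , u∈S , v∈S , u≢v = form-<-top spectrum ∂≤top
        (+-nonNeg (fromNat-nonNeg n) (fromNat-nonNeg ∣ S ∣))
        -- An independent set has at most n elements, so λ⁺ = n + α does not exceed 2n.
        (+-mono-≤ ≤-refl (fromNat-mono-≤ (∣p∣≤n S))) top<N+α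
        (difference-sum u v) (<-respʳ-≈ (sym (∥difference∥² u≢v)) (+-pos-nonNeg 0<1 0≤1))
        (≤-trans (≤-reflexive (trans (*-congˡ (∥difference∥² u≢v))
            (solve 1 (λ x → x :* (con (ℤ.+ 1) :+ con (ℤ.+ 1)) := x :+ x) refl (N + fromNat ∣ S ∣))))
          (≤-trans (+-mono-≤ (independent-transmission independent u∈S) (independent-transmission independent v∈S))
            (≤-reflexive (sym (difference-form u≢v (independent u∈S v∈S))))))

      -- The strict violation is the separation that `form->-bottom` asks for, with μ = 2n - Δ - 1.
      -- The index j is left free; it marks the position of the eigenvalue 0.
      degree-bound : ∀ {Δ} → IsMaxDegree G Δ → ∀ {j bottom} → (∀ i → i ≢ j → bottom ≤ ∂ i) →
        bottom ≤ N + N - (fromNat Δ + 1#)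
      degree-bound isΔ@((v , ≡.refl) , _) bottom≤∂ μ<bottom = form->-bottom spectrum bottom≤∂
        (≤-by (x≤y⇒0≤y-x degree-<) (solve 2 (λ c N → N :+ N :- c :- N := N :- c) refl (k + 1#) N))
        (≤-by (+-nonNeg (fromNat-nonNeg (degree G v)) 0≤1) (solve 2 (λ c N → N :+ N :- (N :+ N :- c) := c) refl (k + 1#) N))
        μ<bottom star-sum 0<∥star∥² star-form
        where
        open Star v
        k = fromNat (degree G v)
        0<k : 0# < k
        0<k = <-≤-trans (fromNat-pos 0) (fromNat-mono-≤ (maxDegree≥1 isΔ))
        0<∥star∥² : 0# < ∥ star ∥²
        0<∥star∥² = <-respʳ-≈ (sym ∥star∥²) (+-pos-nonNeg (*-positive 0<k 0<k) (<⇒≤ 0<k))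

theorem4p5 : ∀ {c ℓ₁ ℓ₂ ℓ₃} (ℝ : RealField c ℓ₁ ℓ₂ ℓ₃) →
    let open RealField ℝ
        open Spectra ℝ
    in
    ∀ {n : ℕ} (G : Graph n) (conn : Connected G) →
    IsDiameter G conn 2 →
    ∀ {Δ α : ℕ} → IsMaxDegree G Δ → IsIndependenceNumber G α →
    ∀ {∂ : Vector Carrier n} → IsSpectrum (distanceLaplacian G conn) ∂ →
    fromNat Δ + fromNat α + 1# - fromNat n ≤ spread ∂
-- With fewer than two vertices there is no pair at distance two, so the default values of `spread`
-- never arise.
theorem4p5 ℝ {0} G conn diam with DiameterTwo.far-pair G conn diam
... | () , _
theorem4p5 ℝ {1} G conn diam with DiameterTwo.far-pair G conn diam
... | zero , zero , 0≢0 , _ = contradiction ≡.refl 0≢0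
theorem4p5 ℝ {suc (suc m)} G conn diam {Δ} {α} isΔ isα {∂} spectrum = ≤-by
  (+-nonNeg
    (x≤y⇒0≤y-x (independence-bound G conn diam spectrum isα λ i → nonIncreasing ℕ.z≤n))
    -- The exempt position is the last. Every other one comes no later than `inject₁ (fromℕ m)`, the
    -- position n - 1 when counted from 1, so monotonicity makes that entry the bottom.
    (x≤y⇒0≤y-x (degree-bound G conn diam spectrum isΔ {j = fromℕ (suc m)} λ i i≢last → nonIncreasing (not-last i i≢last))))
  (solve 6 (λ d a o N t b → t :- b :- (d :+ a :+ o :- N) := t :- (N :+ a) :+ (N :+ N :- (d :+ o) :- b))
    refl (fromNat Δ) (fromNat α) 1# (fromNat (suc (suc m))) (∂ zero) (∂ (inject₁ (fromℕ m))))
  where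
  open RealField ℝ hiding (zero)
  open Spectra ℝ
  open SpreadBound ℝ
  open OrderedField ℝ
  open Solver
  open IsSpectrum spectrum
  not-last : ∀ i → i ≢ fromℕ (suc m) → i Fin.≤ inject₁ (fromℕ m)
  not-last i i≢last = ≡.subst (toℕ i ℕ.≤_)
    (≡.sym (≡.trans (toℕ-inject₁ (fromℕ m)) (toℕ-fromℕ m)))
    (ℕ.s≤s⁻¹ (ℕ.≤∧≢⇒< (toℕ≤pred[n] i) λ eq → i≢last (toℕ-injective (≡.trans eq (≡.sym (toℕ-fromℕ (suc m)))))))
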